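{- Let $h\in SO_{2m+1}(F)$ be semisimple. Then there is a $Y\in GL_{2m+1}(F)$ and an $X\in M_{2m+1}(F)$ such that $Y+\tilde\varepsilon(Y)=XX'$ and $h=-(I-X'Y^{ -1}X)$.
   Context: $F$ is a nonarchimedean local field of characteristic zero. $w=w_{2m+1}$ is the $(2m+1)\times(2m+1)$ antidiagonal matrix with all antidiagonal entries $1$, and $SO_{2m+1}(F)$ is the special orthogonal group of the symmetric form $w$. For $X,Y\in M_{2m+1}(F)$: $\tilde\varepsilon(Y)=w\,{}^tY\,w$ and $X'=-w\,{}^tX\,w$. -}

module Defs where

open import Algebra.Apartness.Bundles using (HeytingField; HeytingCommutativeRing)
open import Algebra.Bundles using (CommutativeRing; Semiring)
import Algebra.Definitions as AlgebraDefinitions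
import Algebra.Definitions.RawMonoid as RawMonoidDefinitions
import Algebra.Definitions.RawSemiring as RawSemiringDefinitions
open import Algebra.Morphism.Structures using (IsRingHomomorphism)
open import Data.Fin.Base using (Fin; zero; suc; toℕ; opposite)
open import Data.Fin.Properties using (_≟_)
open import Data.Integer.Base as ℤ using (ℤ; 0ℤ; 1ℤ)
open import Data.Nat.Base as ℕ using (ℕ; zero; suc)
open import Data.Product.Base using (Σ; _×_; _,_; ∃; ∃-syntax; Σ-syntax)
open import Data.Sum.Base using (_⊎_)
open import Data.Vec.Functional using (Vector; map; removeAt; transpose)
open import Function.Base using (_∘_)
open import Function.Bundles using (_⇔_)
open import Level using (Level; _⊔_) renaming (suc to lsuc)
import Relation.Binary.Construct.Add.Supremum.NonStrict as AddSupremum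
open import Relation.Binary.Core using (Rel)
open import Relation.Binary.PropositionalEquality using (_≡_; _≢_)
open import Relation.Nullary using (¬_; yes; no)
open import Relation.Nullary.Construct.Add.Supremum using (_⁺; ⊤⁺; [_])

private
  variable
    c ℓ ℓ₁ ℓ₂ : Level

module Matrices (R : CommutativeRing c ℓ) where
  open CommutativeRing R
    using (Carrier; _≈_; _+_; _*_; -_; 0#; 1#; semiring; +-rawMonoid)
  open RawMonoidDefinitions +-rawMonoid using (sum)
  open RawSemiringDefinitions (Semiring.rawSemiring semiring) using (_^_)

  infix  4 _≈ᴹ_
  infixl 6 _+ᴹ_ _-ᴹ_
  infixl 7 _*ᴹ_
  infix  8 -ᴹ_ _′

  -- A i j is the entry in row i and column j.
  Matrix : ℕ → Set c
  Matrix n = Vector (Vector Carrier n) n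

  _≈ᴹ_ : ∀ {n} → Rel (Matrix n) ℓ
  A ≈ᴹ B = ∀ i j → A i j ≈ B i j

  _+ᴹ_ : ∀ {n} → Matrix n → Matrix n → Matrix n
  (A +ᴹ B) i j = A i j + B i j

  -ᴹ_ : ∀ {n} → Matrix n → Matrix n
  (-ᴹ A) i j = - A i j

  _-ᴹ_ : ∀ {n} → Matrix n → Matrix n → Matrix n
  A -ᴹ B = A +ᴹ (-ᴹ B)

  _*ᴹ_ : ∀ {n} → Matrix n → Matrix n → Matrix n
  (A *ᴹ B) i j = sum (λ k → A i k * B k j)

  diagonal : ∀ {n} → Vector Carrier n → Matrix n
  diagonal d i j with i ≟ j
  ... | yes _ = d i
  ... | no  _ = 0#

  I : ∀ {n} → Matrix n
  I = diagonal (λ _ → 1#)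

  -- The antidiagonal matrix: entry 1 exactly when i + j = n - 1 (indices from 0).
  w : ∀ {n} → Matrix n
  w i j = I i (opposite j)

  -- Laplace expansion along the first row.
  det : ∀ {n} → Matrix n → Carrier
  det {zero}  A = 1#
  det {suc n} A =
    sum (λ j → (- 1#) ^ toℕ j * (A zero j * det (λ i → removeAt (A (suc i)) j)))

  -- Invertible A is the type of two-sided inverses of A, so it also serves as
  -- membership in GL.
  Invertible : ∀ {n} → Matrix n → Set (c ⊔ ℓ)
  Invertible = AlgebraDefinitions.Invertible _≈ᴹ_ I _*ᴹ_

  record SpecialOrthogonal {n} (h : Matrix n) : Set ℓ where
    field
      preserves-w : transpose h *ᴹ w *ᴹ h ≈ᴹ w
      det≈1       : det h ≈ 1#

  ε̃ : ∀ {n} → Matrix n → Matrix n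
  ε̃ Y = w *ᴹ transpose Y *ᴹ w

  _′ : ∀ {n} → Matrix n → Matrix n
  X ′ = -ᴹ (w *ᴹ transpose X *ᴹ w)

  Diagonalizable : ∀ {n} → Matrix n → Set (c ⊔ ℓ)
  Diagonalizable {n} A =
    Σ[ P ∈ Matrix n ] Σ[ (P⁻¹ , _) ∈ Invertible P ]
      ∃[ d ] P⁻¹ *ᴹ A *ᴹ P ≈ᴹ diagonal d

  -- The value at x of the monic polynomial tⁿ + Σ_{i<n} aᵢ tⁱ.
  evalMonic : ∀ {n} → Vector Carrier n → Carrier → Carrier
  evalMonic {n} a x = x ^ n + sum (λ i → a i * x ^ toℕ i)

fieldRing : HeytingField c ℓ₁ ℓ₂ → CommutativeRing c ℓ₁
fieldRing F = HeytingCommutativeRing.commutativeRing (HeytingField.heytingCommutativeRing F)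

CharacteristicZero : HeytingField c ℓ₁ ℓ₂ → Set ℓ₁
CharacteristicZero F = ∀ n → ¬ (suc n ×ᶠ 1# ≈ 0#)
  where
  open CommutativeRing (fieldRing F)
  open RawMonoidDefinitions +-rawMonoid renaming (_×_ to _×ᶠ_)

open AddSupremum ℤ._≤_ public using (_≤⁺_)

infixl 6 _+⁺_

_+⁺_ : ℤ ⁺ → ℤ ⁺ → ℤ ⁺
[ k ] +⁺ [ l ] = [ k ℤ.+ l ]
[ _ ] +⁺ ⊤⁺    = ⊤⁺
⊤⁺    +⁺ _     = ⊤⁺

-- A field complete with respect to a normalised discrete valuation with finite
-- residue field.  The valuation takes values in ℤ ⁺ = ℤ ∪ {∞}, so it makes
-- _#_ and _≈_ decidable.
record NonarchimedeanLocalField c ℓ₁ ℓ₂ : Set (lsuc (c ⊔ ℓ₁ ⊔ ℓ₂)) where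
  field
    heytingField : HeytingField c ℓ₁ ℓ₂

  open HeytingField heytingField

  field
    v            : Carrier → ℤ ⁺
    v-cong       : ∀ {x y} → x ≈ y → v x ≡ v y
    v-finite     : ∀ x → v x ≢ ⊤⁺ ⇔ x # 0#
    v-*          : ∀ x y → v (x * y) ≡ v x +⁺ v y
    -- v (x + y) ≥ min (v x) (v y)
    v-+          : ∀ x y → v x ≤⁺ v (x + y) ⊎ v y ≤⁺ v (x + y)
    v-normalised : ∃[ π ] v π ≡ [ 1ℤ ]

  Cauchy : (ℕ → Carrier) → Set
  Cauchy u = ∀ (k : ℤ) → ∃[ N ] ∀ m n → N ℕ.≤ m → N ℕ.≤ n → [ k ] ≤⁺ v (u m - u n)

  _⟶_ : (ℕ → Carrier) → Carrier → Set
  u ⟶ x = ∀ (k : ℤ) → ∃[ N ] ∀ n → N ℕ.≤ n → [ k ] ≤⁺ v (u n - x)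

  field
    complete       : ∀ u → Cauchy u → ∃[ x ] u ⟶ x
    -- Finitely many elements represent every class of {v ≥ 0} modulo {v ≥ 1}.
    residue-finite : ∃[ q ] Σ[ r ∈ Vector Carrier q ]
                       ∀ x → [ 0ℤ ] ≤⁺ v x → ∃[ i ] [ 1ℤ ] ≤⁺ v (x - r i)

record AlgebraicClosure (F : HeytingField c ℓ₁ ℓ₂) c′ ℓ₁′ ℓ₂′
       : Set (c ⊔ ℓ₁ ⊔ lsuc (c′ ⊔ ℓ₁′ ⊔ ℓ₂′)) where
  field
    closure : HeytingField c′ ℓ₁′ ℓ₂′

  private
    module F  = CommutativeRing (fieldRing F)
    module F̄  = CommutativeRing (fieldRing closure)
  open Matrices (fieldRing closure) using (evalMonic)

  field
    ι                : F.Carrier → F̄.Carrier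
    ι-homomorphism   : IsRingHomomorphism F.rawRing F̄.rawRing ι
    algebraic        : ∀ x → ∃[ n ] Σ[ a ∈ Vector F.Carrier n ]
                         evalMonic (map ι a) x F̄.≈ F̄.0#
    algebraicallyClosed : ∀ n (a : Vector F̄.Carrier (suc n)) →
                         ∃[ x ] evalMonic a x F̄.≈ F̄.0#

module _ {F : HeytingField c ℓ₁ ℓ₂} {c′ ℓ₁′ ℓ₂′} (F̄ : AlgebraicClosure F c′ ℓ₁′ ℓ₂′) where
  open AlgebraicClosure F̄

  Semisimple : ∀ {n} → Matrices.Matrix (fieldRing F) n → Set (c′ ⊔ ℓ₁′)
  Semisimple h = Matrices.Diagonalizable (fieldRing closure) (map (map ι) h)

{-# OPTIONS --safe #-}
module Submission where

-- Put g = h + 1.  Since h is semisimple, V = ker g ⊕ im g; let q be the projection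
-- onto ker g along im g.  It is self-adjoint because h is orthogonal, so the sum is
-- orthogonal.  If s is a skew-adjoint automorphism of ker g, extended by zero, then
-- Y⁻¹ = - (g + s) and X = 1 - q solve the two equations; here Y + ε̃(Y) = X X′ is the
-- Cayley-transform identity (g⁻¹)* + g⁻¹ = 1 on im g.
--
-- Such an s exists iff ker g is even-dimensional.  From g + q = h (g + q)* (1 - 2q) and
-- the invertibility of g + q one gets det (1 - 2q) = det h = 1, while 1 - 2q is a
-- product of dim (ker g) reflections, each of determinant -1.

open import Defs
open import Algebra.Apartness.Bundles using (HeytingField)
open import Algebra.Bundles using (CommutativeRing; Ring; Semiring)
open import Algebra.Core using (Op₁)
import Algebra.Definitions.RawSemiring as RawSemiringDefinitions
open import Algebra.Morphism.Structures using (IsRingHomomorphism)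
import Algebra.Properties.CommutativeSemigroup as CommutativeSemigroupProperties
import Algebra.Properties.Ring as RingProperties
import Algebra.Properties.Semiring.Sum as SemiringSum
open import Data.Fin.Base using (Fin; zero; suc; opposite; punchIn; punchOut; toℕ)
import Data.Fin.Permutation as Perm
open import Data.Fin.Properties
  using (_≟_; all?; ¬∀⟶∃¬; suc-injective; opposite-involutive;
         punchIn-punchOut; punchIn-injective; punchInᵢ≢i)
open import Data.List.Base using (List; []; _∷_; allFin)
open import Data.List.Membership.Propositional using (_∈_)
open import Data.List.Membership.Propositional.Properties using (∈-allFin)
open import Data.List.Relation.Unary.Any using (here; there)
open import Data.Maybe.Base using (just; nothing)
open import Data.Nat.Base using (ℕ; suc)
open import Data.Product.Base using (Σ-syntax; _×_; _,_; proj₁; proj₂)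
open import Data.Sum.Base using (_⊎_; inj₁; inj₂)
open import Data.Unit.Polymorphic.Base using (⊤; tt)
open import Data.Vec.Functional
  using (Vector; transpose; updateAt; removeAt; insertAt; tail; map) renaming (_∷_ to _◂_)
open import Data.Vec.Functional.Properties
  using (updateAt-updates; updateAt-minimal; updateAt-commutes; insertAt-lookup; insertAt-punchIn)
open import Function.Base using (_∘_)
open import Function.Bundles using (module Equivalence)
open import Level using (Level; _⊔_)
open import Relation.Binary.PropositionalEquality as ≡ using (_≡_; _≢_)
import Relation.Binary.Reasoning.Setoid as SetoidReasoning
open import Relation.Nullary using (¬_; Dec; yes; no; contradiction)

private
  variable
    a c ℓ ℓ₁ ℓ₂ c′ ℓ₁′ ℓ₂′ : Level

-- The obstacle is that semisimplicity speaks of the algebraic closure while `Y` and `X` must have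
-- entries in the base field. No eigenspace is descended. The only consequence carried down is that
-- g (g A) = 0 forces g A = 0, an equation of matrices over the base field that can be tested after
-- `ι`. The projection comes from solving g² x = g over the base field. By the Fredholm alternative
-- the only obstruction is a row y with y g² = 0 and y g ≠ 0. Since g* = h* g, passing to adjoints
-- turns such a row into a violation of the previous implication. Then q = 1 - g x. No dimension is
-- ever counted. The image of q is split into orthogonal anisotropic lines, which is possible
-- because 2 is invertible and zero is decidable. Two lines at a time carry an explicit skew unit,
-- and a line left over would make det (1 - 2q) equal to -1. The identities about g, q and s involve
-- nothing but a ring with involution, so they are proved there; matrices enter for solvability, for
-- determinants and for the lines.

record IsInvolution (R : Ring a ℓ) (_⋆ : Op₁ (Ring.Carrier R)) : Set (a ⊔ ℓ) where
  open Ring R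
  field
    ⋆-cong       : ∀ {x y} → x ≈ y → x ⋆ ≈ y ⋆
    ⋆-+          : ∀ x y → (x + y) ⋆ ≈ x ⋆ + y ⋆
    ⋆-*          : ∀ x y → (x * y) ⋆ ≈ y ⋆ * x ⋆
    ⋆-involutive : ∀ x → x ⋆ ⋆ ≈ x

-- Self-adjoint idempotents and skew units in a ring with involution.

module RingLemmas (R : Ring a ℓ) where
  open Ring R
  open RingProperties R
  open SetoidReasoning setoid

  pullˡ : ∀ {x y z} w → x * y ≈ z → x * (y * w) ≈ z * w
  pullˡ w xy≈z = trans (sym (*-assoc _ _ w)) (*-congʳ xy≈z)

  killˡ : ∀ {x y} w → x * y ≈ 0# → x * (y * w) ≈ 0#
  killˡ w xy≈0 = trans (pullˡ w xy≈0) (zeroˡ w)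

  killʳ : ∀ {x y} w → x * y ≈ 0# → (w * x) * y ≈ 0#
  killʳ w xy≈0 = trans (*-assoc w _ _) (trans (*-congˡ xy≈0) (zeroʳ w))

  +-dropˡ : ∀ {x y} → x ≈ 0# → x + y ≈ y
  +-dropˡ x≈0 = trans (+-congʳ x≈0) (+-identityˡ _)

  +-dropʳ : ∀ {x y} → y ≈ 0# → x + y ≈ x
  +-dropʳ y≈0 = trans (+-congˡ y≈0) (+-identityʳ _)

  neg-*-neg : ∀ x y → - x * - y ≈ x * y
  neg-*-neg x y = begin
    - x * - y      ≈⟨ -‿distribˡ-* x (- y) ⟨
    - (x * - y)    ≈⟨ -‿cong (-‿distribʳ-* x y) ⟨
    - - (x * y)    ≈⟨ -‿involutive (x * y) ⟩
    x * y          ∎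

  [x+y]-y : ∀ x y → (x + y) - y ≈ x
  [x+y]-y x y = trans (+-assoc x y (- y)) (+-dropʳ (-‿inverseʳ y))

  foil : ∀ x y z w → (x + y) * (z + w) ≈ (x * z + x * w) + (y * z + y * w)
  foil x y z w = trans (distribʳ _ x y) (+-cong (distribˡ x z w) (distribˡ y z w))

module StarRing (R : Ring a ℓ) (_⋆ : Op₁ (Ring.Carrier R)) (isInvolution : IsInvolution R _⋆) where
  open Ring R
  open RingProperties R
  open RingLemmas R
  open SetoidReasoning setoid
  open IsInvolution isInvolution

  ⋆-1 : 1# ⋆ ≈ 1#
  ⋆-1 = begin
    1# ⋆             ≈⟨ *-identityʳ _ ⟨
    1# ⋆ * 1#        ≈⟨ *-congˡ (⋆-involutive 1#) ⟨
    1# ⋆ * (1# ⋆) ⋆  ≈⟨ ⋆-* (1# ⋆) 1# ⟨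
    (1# ⋆ * 1#) ⋆    ≈⟨ ⋆-cong (*-identityʳ _) ⟩
    1# ⋆ ⋆           ≈⟨ ⋆-involutive 1# ⟩
    1#               ∎

  ⋆-0 : 0# ⋆ ≈ 0#
  ⋆-0 = x+x≈x⇒x≈0 _ (trans (sym (⋆-+ 0# 0#)) (⋆-cong (+-identityˡ 0#)))

  ⋆-neg : ∀ x → (- x) ⋆ ≈ - (x ⋆)
  ⋆-neg x = +-inverseʳ-unique _ _ (trans (sym (⋆-+ x (- x))) (trans (⋆-cong (-‿inverseʳ x)) ⋆-0))

  -- The adjoint of the left-hand absorption is the right-hand one, up to a sign on both sides. This
  -- is why `SkewUnit` records absorption on the left alone.
  skew-absorbʳ : ∀ {q u} → q ⋆ ≈ q → u ⋆ ≈ - u → q * u ≈ u → u * q ≈ u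
  skew-absorbʳ {q} {u} q⋆≈q u⋆≈-u qu≈u = -‿injective (begin
    - (u * q)    ≈⟨ -‿distribˡ-* u q ⟩
    - u * q      ≈⟨ *-cong u⋆≈-u q⋆≈q ⟨
    u ⋆ * q ⋆    ≈⟨ ⋆-* q u ⟨
    (q * u) ⋆    ≈⟨ ⋆-cong qu≈u ⟩
    u ⋆          ≈⟨ u⋆≈-u ⟩
    - u          ∎)

  -- Products between orthogonal corners vanish: an idempotent absorbed by one factor is inserted
  -- between the two and kills the other.
  viaˡ : ∀ {q u v} → q * v ≈ v → u * q ≈ 0# → u * v ≈ 0#
  viaˡ qv≈v uq≈0 = trans (*-congˡ (sym qv≈v)) (killˡ _ uq≈0)

  viaʳ : ∀ {q u v} → u * q ≈ u → q * v ≈ 0# → u * v ≈ 0#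
  viaʳ uq≈u qv≈0 = trans (*-congʳ (sym uq≈u)) (killʳ _ qv≈0)

  -- A skew-adjoint unit of the corner ring q R q; for a self-adjoint idempotent
  -- matrix q it exists exactly when the rank of q is even.
  record SkewUnit (q : Carrier) : Set (a ⊔ ℓ) where
    field
      {s t}  : Carrier
      s⋆≈-s  : s ⋆ ≈ - s
      t⋆≈-t  : t ⋆ ≈ - t
      qs≈s   : q * s ≈ s
      qt≈t   : q * t ≈ t
      st≈q   : s * t ≈ q

  skewUnit-cong : ∀ {q r} → q ≈ r → SkewUnit q → SkewUnit r
  skewUnit-cong q≈r U = record
    { s⋆≈-s = s⋆≈-s ; t⋆≈-t = t⋆≈-t
    ; qs≈s = trans (*-congʳ (sym q≈r)) qs≈s ; qt≈t = trans (*-congʳ (sym q≈r)) qt≈t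
    ; st≈q = trans st≈q q≈r }
    where open SkewUnit U

  skewUnit-0 : SkewUnit 0#
  skewUnit-0 = record
    { s⋆≈-s = trans ⋆-0 (sym -0#≈0#) ; t⋆≈-t = trans ⋆-0 (sym -0#≈0#)
    ; qs≈s = zeroˡ 0# ; qt≈t = zeroˡ 0# ; st≈q = zeroˡ 0# }

  orthogonal-sym : ∀ {q e} → q ⋆ ≈ q → e ⋆ ≈ e → q * e ≈ 0# → e * q ≈ 0#
  orthogonal-sym {q} {e} q⋆≈q e⋆≈e qe≈0 = begin
    e * q        ≈⟨ *-cong e⋆≈e q⋆≈q ⟨
    e ⋆ * q ⋆    ≈⟨ ⋆-* q e ⟨
    (q * e) ⋆    ≈⟨ ⋆-cong qe≈0 ⟩
    0# ⋆         ≈⟨ ⋆-0 ⟩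
    0#           ∎

  -- The block-diagonal sum. The mixed products vanish because one factor ends in `q` and the other
  -- begins with `e`, or the reverse.
  skewUnit-+ : ∀ {q e} → q ⋆ ≈ q → e ⋆ ≈ e → q * e ≈ 0# → SkewUnit q → SkewUnit e → SkewUnit (q + e)
  skewUnit-+ {q} {e} q⋆≈q e⋆≈e qe≈0 U V = record
    { s⋆≈-s = skew-+ U.s⋆≈-s V.s⋆≈-s
    ; t⋆≈-t = skew-+ U.t⋆≈-t V.t⋆≈-t
    ; qs≈s = absorb-+ U.qs≈s V.qs≈s
    ; qt≈t = absorb-+ U.qt≈t V.qt≈t
    ; st≈q = begin
        (U.s + V.s) * (U.t + V.t)                          ≈⟨ foil _ _ _ _ ⟩
        (U.s * U.t + U.s * V.t) + (V.s * U.t + V.s * V.t)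
          ≈⟨ +-cong (+-dropʳ (viaʳ (skew-absorbʳ q⋆≈q U.s⋆≈-s U.qs≈s) (viaˡ V.qt≈t qe≈0)))
                    (+-dropˡ (viaʳ (skew-absorbʳ e⋆≈e V.s⋆≈-s V.qs≈s) (viaˡ U.qt≈t eq≈0))) ⟩
        U.s * U.t + V.s * V.t                              ≈⟨ +-cong U.st≈q V.st≈q ⟩
        q + e                                              ∎
    }
    where
    module U = SkewUnit U
    module V = SkewUnit V
    eq≈0 : e * q ≈ 0#
    eq≈0 = orthogonal-sym q⋆≈q e⋆≈e qe≈0
    skew-+ : ∀ {x y} → x ⋆ ≈ - x → y ⋆ ≈ - y → (x + y) ⋆ ≈ - (x + y)
    skew-+ {x} {y} x⋆≈-x y⋆≈-y = trans (⋆-+ x y) (trans (+-cong x⋆≈-x y⋆≈-y) (-‿+-comm x y))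
    absorb-+ : ∀ {x y} → q * x ≈ x → e * y ≈ y → (q + e) * (x + y) ≈ x + y
    absorb-+ {x} {y} qx≈x ey≈y = begin
      (q + e) * (x + y)                    ≈⟨ foil q e x y ⟩
      (q * x + q * y) + (e * x + e * y)    ≈⟨ +-cong (+-dropʳ (viaˡ ey≈y qe≈0)) (+-dropˡ (viaˡ qx≈x eq≈0)) ⟩
      q * x + e * y                        ≈⟨ +-cong qx≈x ey≈y ⟩
      x + y                                ∎

  -- Geometrically, `e` projects onto a subspace of the image of `q`, and `q - e` onto the
  -- orthogonal complement of that subspace in the image.
  module Complement {q e : Carrier} (q⋆≈q : q ⋆ ≈ q) (qq≈q : q * q ≈ q)
                    (e⋆≈e : e ⋆ ≈ e) (ee≈e : e * e ≈ e) (qe≈e : q * e ≈ e) where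

    eq≈e : e * q ≈ e
    eq≈e = begin
      e * q        ≈⟨ *-cong e⋆≈e q⋆≈q ⟨
      e ⋆ * q ⋆    ≈⟨ ⋆-* q e ⟨
      (q * e) ⋆    ≈⟨ ⋆-cong qe≈e ⟩
      e ⋆          ≈⟨ e⋆≈e ⟩
      e            ∎

    complement-⋆ : (q - e) ⋆ ≈ q - e
    complement-⋆ = trans (⋆-+ q (- e)) (+-cong q⋆≈q (trans (⋆-neg e) (-‿cong e⋆≈e)))

    complement-e : (q - e) * e ≈ 0#
    complement-e = trans ([y-z]x≈yx-zx e q e) (trans (+-cong qe≈e (-‿cong ee≈e)) (-‿inverseʳ e))

    complement-idempotent : (q - e) * (q - e) ≈ q - e
    complement-idempotent = begin
      (q - e) * (q - e)              ≈⟨ x[y-z]≈xy-xz _ q e ⟩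
      (q - e) * q - (q - e) * e      ≈⟨ +-congˡ (trans (-‿cong complement-e) -0#≈0#) ⟩
      (q - e) * q + 0#               ≈⟨ +-identityʳ _ ⟩
      (q - e) * q                    ≈⟨ [y-z]x≈yx-zx q q e ⟩
      q * q - e * q                  ≈⟨ +-cong qq≈q (-‿cong eq≈e) ⟩
      q - e                          ∎

    complement-+ : (q - e) + e ≈ q
    complement-+ = trans (+-assoc q (- e) e) (+-dropʳ (-‿inverseˡ e))

    -- The first factor fixes `e` because `(q - e) * e` vanishes, so the product only subtracts
    -- `e + e` from it. When `e` is a line, this takes one reflection off `1 - 2q`.
    reflection-* : (1# - ((q - e) + (q - e))) * (1# - (e + e)) ≈ 1# - (q + q)
    reflection-* = begin
      (1# - (r + r)) * (1# - (e + e))                              ≈⟨ x[y-z]≈xy-xz _ 1# (e + e) ⟩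
      (1# - (r + r)) * 1# - (1# - (r + r)) * (e + e)               ≈⟨ +-cong (*-identityʳ _) (-‿cong (trans (distribˡ _ e e) (+-cong reflection-e reflection-e))) ⟩
      (1# - (r + r)) - (e + e)                                     ≈⟨ +-assoc 1# _ _ ⟩
      1# + (- (r + r) - (e + e))                                   ≈⟨ +-congˡ (-‿+-comm _ _) ⟩
      1# - ((r + r) + (e + e))                                     ≈⟨ +-congˡ (-‿cong (begin
        (r + r) + (e + e)                                            ≈⟨ +-assoc r r _ ⟩
        r + (r + (e + e))                                            ≈⟨ +-congˡ (trans (sym (+-assoc r e e)) (+-comm _ e)) ⟩
        r + (e + (r + e))                                            ≈⟨ +-assoc r e _ ⟨
        (r + e) + (r + e)                                            ≈⟨ +-cong complement-+ complement-+ ⟩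
        q + q                                                        ∎)) ⟩
      1# - (q + q)                                                 ∎
      where
      r : Carrier
      r = q - e
      reflection-e : (1# - (r + r)) * e ≈ e
      reflection-e = begin
        (1# - (r + r)) * e          ≈⟨ [y-z]x≈yx-zx e 1# _ ⟩
        1# * e - (r + r) * e        ≈⟨ +-cong (*-identityˡ e) (-‿cong (trans (distribʳ e r r) (+-cong complement-e complement-e))) ⟩
        e - (0# + 0#)               ≈⟨ +-dropʳ (trans (-‿cong (+-identityˡ 0#)) -0#≈0#) ⟩
        e                           ∎

  -- Orthogonal elements: the kernel and the image of h + 1.

  module OrthogonalElement
    (h : Carrier) (h⋆h≈1 : h ⋆ * h ≈ 1#) (hh⋆≈1 : h * h ⋆ ≈ 1#)
    -- The ring form of the statement that g² has the same kernel as g, so that the kernel and the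
    -- image of g meet in zero.
    (reduced : ∀ x → (h + 1#) * ((h + 1#) * x) ≈ 0# → (h + 1#) * x ≈ 0#)
    where

    g : Carrier
    g = h + 1#

    g⋆≈h⋆+1 : g ⋆ ≈ h ⋆ + 1#
    g⋆≈h⋆+1 = trans (⋆-+ h 1#) (+-congˡ ⋆-1)

    -- Since `h ⋆` is invertible, g and its adjoint have the same kernel. Everything that passes
    -- from g to `g ⋆` below rests on this.
    g⋆≈h⋆g : g ⋆ ≈ h ⋆ * g
    g⋆≈h⋆g = begin
      g ⋆                 ≈⟨ g⋆≈h⋆+1 ⟩
      h ⋆ + 1#            ≈⟨ +-comm _ _ ⟩
      1# + h ⋆            ≈⟨ +-cong h⋆h≈1 (*-identityʳ _) ⟨
      h ⋆ * h + h ⋆ * 1#  ≈⟨ distribˡ (h ⋆) h 1# ⟨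
      h ⋆ * g             ∎

    hg⋆≈g : h * g ⋆ ≈ g
    hg⋆≈g = begin
      h * g ⋆           ≈⟨ *-congˡ g⋆≈h⋆g ⟩
      h * (h ⋆ * g)     ≈⟨ pullˡ g hh⋆≈1 ⟩
      1# * g            ≈⟨ *-identityˡ g ⟩
      g                 ∎

    -- The Cayley identity before inversion: placed between `n ⋆` and `n` it becomes `n⋆+n≈p`.
    g⋆g≈g⋆+g : g ⋆ * g ≈ g ⋆ + g
    g⋆g≈g⋆+g = begin
      g ⋆ * g             ≈⟨ *-congʳ g⋆≈h⋆+1 ⟩
      (h ⋆ + 1#) * g      ≈⟨ distribʳ g (h ⋆) 1# ⟩
      h ⋆ * g + 1# * g    ≈⟨ +-cong (sym g⋆≈h⋆g) (*-identityˡ g) ⟩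
      g ⋆ + g             ∎

    -- The adjoint of the hypothesis is g⋆ g⋆ y⋆ = 0. As g = h g⋆ and g commutes with g⋆, it follows
    -- that g g y⋆ = h h g⋆ g⋆ y⋆ = 0, and `reduced` applies to `y ⋆`. This left-hand form is what
    -- rules out the obstruction to solving g² x = g.
    reducedˡ : ∀ y → y * (g * g) ≈ 0# → y * g ≈ 0#
    reducedˡ y ygg≈0 = begin
      y * g            ≈⟨ ⋆-involutive (y * g) ⟨
      (y * g) ⋆ ⋆      ≈⟨ ⋆-cong (⋆-* y g) ⟩
      (g ⋆ * y ⋆) ⋆    ≈⟨ ⋆-cong (trans (g⋆-* (y ⋆)) (trans (*-congˡ (reduced (y ⋆) ggy⋆≈0)) (zeroʳ (h ⋆)))) ⟩
      0# ⋆             ≈⟨ ⋆-0 ⟩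
      0#               ∎
      where
      g⋆-* : ∀ z → g ⋆ * z ≈ h ⋆ * (g * z)
      g⋆-* z = trans (*-congʳ g⋆≈h⋆g) (*-assoc (h ⋆) g z)
      h[g⋆-*] : ∀ z → h * (g ⋆ * z) ≈ g * z
      h[g⋆-*] z = pullˡ z hg⋆≈g
      g-g⋆-comm : g * g ⋆ ≈ g ⋆ * g
      g-g⋆-comm = begin
        (h + 1#) * g ⋆        ≈⟨ distribʳ (g ⋆) h 1# ⟩
        h * g ⋆ + 1# * g ⋆    ≈⟨ +-cong hg⋆≈g (*-identityˡ (g ⋆)) ⟩
        g + g ⋆               ≈⟨ +-comm g (g ⋆) ⟩
        g ⋆ + g               ≈⟨ g⋆g≈g⋆+g ⟨
        g ⋆ * g               ∎
      g⋆g⋆y⋆≈0 : g ⋆ * (g ⋆ * y ⋆) ≈ 0#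
      g⋆g⋆y⋆≈0 = begin
        g ⋆ * (g ⋆ * y ⋆)    ≈⟨ *-assoc (g ⋆) (g ⋆) (y ⋆) ⟨
        g ⋆ * g ⋆ * y ⋆      ≈⟨ *-congʳ (⋆-* g g) ⟨
        (g * g) ⋆ * y ⋆      ≈⟨ ⋆-* y (g * g) ⟨
        (y * (g * g)) ⋆      ≈⟨ ⋆-cong ygg≈0 ⟩
        0# ⋆                 ≈⟨ ⋆-0 ⟩
        0#                   ∎
      ggy⋆≈0 : g * (g * y ⋆) ≈ 0#
      ggy⋆≈0 = begin
        g * (g * y ⋆)                ≈⟨ h[g⋆-*] (g * y ⋆) ⟨
        h * (g ⋆ * (g * y ⋆))        ≈⟨ *-congˡ (pullˡ (y ⋆) (sym g-g⋆-comm)) ⟩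
        h * (g * g ⋆ * y ⋆)          ≈⟨ *-congˡ (*-assoc g (g ⋆) (y ⋆)) ⟩
        h * (g * (g ⋆ * y ⋆))        ≈⟨ *-congˡ (h[g⋆-*] (g ⋆ * y ⋆)) ⟨
        h * (h * (g ⋆ * (g ⋆ * y ⋆)))    ≈⟨ *-congˡ (trans (*-congˡ g⋆g⋆y⋆≈0) (zeroʳ h)) ⟩
        h * 0#                       ≈⟨ zeroʳ h ⟩
        0#                           ∎

    -- `p` is the projection onto the image of g along its kernel, and `n` is the inverse of g on
    -- that image, extended by zero. The solution `x` is one-sided and arbitrary on the kernel; the
    -- sandwich `p * (x * p)` removes that ambiguity.
    module GroupInverse (x : Carrier) (ggx≈g : g * (g * x) ≈ g) where

      p q n : Carrier
      p = g * x
      q = 1# - p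
      n = p * (x * p)

      p+q≈1 : p + q ≈ 1#
      p+q≈1 = begin
        p + (1# - p)    ≈⟨ +-congˡ (+-comm 1# (- p)) ⟩
        p + (- p + 1#)  ≈⟨ +-assoc p (- p) 1# ⟨
        (p - p) + 1#    ≈⟨ +-dropˡ (-‿inverseʳ p) ⟩
        1#              ∎

      splitˡ : ∀ y → y ≈ p * y + q * y
      splitˡ y = begin
        y              ≈⟨ *-identityˡ y ⟨
        1# * y         ≈⟨ *-congʳ p+q≈1 ⟨
        (p + q) * y    ≈⟨ distribʳ y p q ⟩
        p * y + q * y  ∎

      splitʳ : ∀ y → y ≈ y * p + y * q
      splitʳ y = begin
        y              ≈⟨ *-identityʳ y ⟨
        y * 1#         ≈⟨ *-congˡ p+q≈1 ⟨
        y * (p + q)    ≈⟨ distribˡ y p q ⟩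
        y * p + y * q  ∎

      gq≈0 : g * q ≈ 0#
      gq≈0 = begin
        g * (1# - p)    ≈⟨ x[y-z]≈xy-xz g 1# p ⟩
        g * 1# - g * p  ≈⟨ +-cong (*-identityʳ g) (-‿cong ggx≈g) ⟩
        g - g           ≈⟨ -‿inverseʳ g ⟩
        0#              ∎

      -- The element `q * g` is again of the form g y and is killed by g, since `g * q` vanishes; so
      -- `reduced` makes it zero. This turns the one-sided equation for `x` into a two-sided
      -- splitting.
      qg≈0 : q * g ≈ 0#
      qg≈0 = trans qg≈gy (reduced _ (trans (*-congˡ (sym qg≈gy)) (killˡ g gq≈0)))
        where
        qg≈gy : q * g ≈ g * (1# - x * g)
        qg≈gy = begin
          (1# - p) * g            ≈⟨ [y-z]x≈yx-zx g 1# p ⟩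
          1# * g - g * x * g      ≈⟨ +-cong (trans (*-identityˡ g) (sym (*-identityʳ g))) (-‿cong (*-assoc g x g)) ⟩
          g * 1# - g * (x * g)    ≈⟨ x[y-z]≈xy-xz g 1# (x * g) ⟨
          g * (1# - x * g)        ∎

      pg≈g : p * g ≈ g
      pg≈g = sym (trans (splitˡ g) (+-dropʳ qg≈0))

      pp≈p : p * p ≈ p
      pp≈p = pullˡ x pg≈g

      qp≈0 : q * p ≈ 0#
      qp≈0 = killˡ x qg≈0

      qq≈q : q * q ≈ q
      qq≈q = sym (trans (splitʳ q) (+-dropˡ qp≈0))

      pq≈0 : p * q ≈ 0#
      pq≈0 = +-identityˡ-unique _ q (trans (+-congˡ (sym qq≈q)) (sym (splitˡ q)))

      g⋆q≈0 : g ⋆ * q ≈ 0#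
      g⋆q≈0 = trans (*-congʳ g⋆≈h⋆g) (killʳ (h ⋆) gq≈0)

      q⋆g≈0 : q ⋆ * g ≈ 0#
      q⋆g≈0 = begin
        q ⋆ * g         ≈⟨ *-congˡ (⋆-involutive g) ⟨
        q ⋆ * g ⋆ ⋆     ≈⟨ ⋆-* (g ⋆) q ⟨
        (g ⋆ * q) ⋆     ≈⟨ ⋆-cong g⋆q≈0 ⟩
        0# ⋆            ≈⟨ ⋆-0 ⟩
        0#              ∎

      -- The adjoint of `g⋆q≈0` gives `q ⋆ * g ≈ 0#`, hence `q ⋆ * p ≈ 0#` and `q ⋆ ≈ q ⋆ * q`. The
      -- right-hand side is self-adjoint, so `q ⋆` is too.
      q⋆≈q : q ⋆ ≈ q
      q⋆≈q = sym (begin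
        q              ≈⟨ ⋆-involutive q ⟨
        q ⋆ ⋆          ≈⟨ ⋆-cong q⋆≈q⋆q ⟩
        (q ⋆ * q) ⋆    ≈⟨ ⋆-* (q ⋆) q ⟩
        q ⋆ * q ⋆ ⋆    ≈⟨ *-congˡ (⋆-involutive q) ⟩
        q ⋆ * q        ≈⟨ q⋆≈q⋆q ⟨
        q ⋆            ∎)
        where
        q⋆≈q⋆q : q ⋆ ≈ q ⋆ * q
        q⋆≈q⋆q = trans (splitʳ (q ⋆)) (+-dropˡ (killˡ x q⋆g≈0))

      p⋆≈p : p ⋆ ≈ p
      p⋆≈p = +-cancelʳ q _ _ (begin
        p ⋆ + q      ≈⟨ +-congˡ q⋆≈q ⟨
        p ⋆ + q ⋆    ≈⟨ ⋆-+ p q ⟨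
        (p + q) ⋆    ≈⟨ ⋆-cong p+q≈1 ⟩
        1# ⋆         ≈⟨ ⋆-1 ⟩
        1#           ≈⟨ p+q≈1 ⟨
        p + q        ∎)

      gn≈p : g * n ≈ p
      gn≈p = begin
        g * (p * (x * p))  ≈⟨ pullˡ (x * p) ggx≈g ⟩
        g * (x * p)        ≈⟨ *-assoc g x p ⟨
        p * p              ≈⟨ pp≈p ⟩
        p                  ∎

      pn≈n : p * n ≈ n
      pn≈n = pullˡ (x * p) pp≈p

      qn≈0 : q * n ≈ 0#
      qn≈0 = killˡ (x * p) qp≈0

      nq≈0 : n * q ≈ 0#
      nq≈0 = trans (*-congʳ (sym (*-assoc p x p))) (killʳ (p * x) pq≈0)

      -- As for `qg≈0`: the difference of the two sides lies in the image of g and is killed by g.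
      ng≈p : n * g ≈ p
      ng≈p = x∙y⁻¹≈ε⇒x≈y _ _ (trans ng-p≈gy (reduced _ (trans (*-congˡ (sym ng-p≈gy)) g[ng-p]≈0)))
        where
        ng≈pxg : n * g ≈ p * (x * g)
        ng≈pxg = begin
          p * (x * p) * g      ≈⟨ *-assoc p (x * p) g ⟩
          p * (x * p * g)      ≈⟨ *-congˡ (*-assoc x p g) ⟩
          p * (x * (p * g))    ≈⟨ *-congˡ (*-congˡ pg≈g) ⟩
          p * (x * g)          ∎
        ng-p≈gy : n * g - p ≈ g * (x * (x * g) - x)
        ng-p≈gy = trans (+-congʳ (trans ng≈pxg (*-assoc g x (x * g)))) (sym (x[y-z]≈xy-xz g _ x))
        g[ng-p]≈0 : g * (n * g - p) ≈ 0#
        g[ng-p]≈0 = begin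
          g * (n * g - p)            ≈⟨ x[y-z]≈xy-xz g _ p ⟩
          g * (n * g) - g * p        ≈⟨ +-cong (trans (pullˡ g gn≈p) pg≈g) (-‿cong ggx≈g) ⟩
          g - g                      ≈⟨ -‿inverseʳ g ⟩
          0#                         ∎

      -- With `n ⋆ * g ⋆ ≈ p` and `g * n ≈ p`, the sum is n⋆ (g⋆ + g) n. The Cayley identity
      -- replaces the bracket by g⋆ g, and both outer pairs collapse.
      n⋆+n≈p : n ⋆ + n ≈ p
      n⋆+n≈p = begin
        n ⋆ + n                        ≈⟨ +-cong (trans (⋆-cong (sym pn≈n)) (⋆-* p n)) (sym pn≈n) ⟩
        n ⋆ * p ⋆ + p * n              ≈⟨ +-congʳ (*-congˡ (trans p⋆≈p (sym gn≈p))) ⟩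
        n ⋆ * (g * n) + p * n          ≈⟨ +-cong (sym (*-assoc (n ⋆) g n)) (*-congʳ (sym n⋆g⋆≈p)) ⟩
        n ⋆ * g * n + n ⋆ * g ⋆ * n    ≈⟨ distribʳ n _ _ ⟨
        (n ⋆ * g + n ⋆ * g ⋆) * n      ≈⟨ *-congʳ (trans (+-comm _ _) (sym (distribˡ (n ⋆) (g ⋆) g))) ⟩
        n ⋆ * (g ⋆ + g) * n            ≈⟨ *-congʳ (*-congˡ g⋆g≈g⋆+g) ⟨
        n ⋆ * (g ⋆ * g) * n            ≈⟨ *-congʳ (pullˡ g n⋆g⋆≈p) ⟩
        p * g * n                      ≈⟨ *-congʳ pg≈g ⟩
        g * n                          ≈⟨ gn≈p ⟩
        p                              ∎
        where
        n⋆g⋆≈p : n ⋆ * g ⋆ ≈ p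
        n⋆g⋆≈p = trans (sym (⋆-* g n)) (trans (⋆-cong gn≈p) p⋆≈p)

      -- Makes the determinant of `g + q` cancellable.
      [g+q][n+q]≈1 : (g + q) * (n + q) ≈ 1#
      [g+q][n+q]≈1 = begin
        (g + q) * (n + q)                    ≈⟨ foil g q n q ⟩
        (g * n + g * q) + (q * n + q * q)    ≈⟨ +-cong (+-cong gn≈p gq≈0) (+-cong qn≈0 qq≈q) ⟩
        (p + 0#) + (0# + q)                  ≈⟨ +-cong (+-identityʳ p) (+-identityˡ q) ⟩
        p + q                                ≈⟨ p+q≈1 ⟩
        1#                                   ∎

      hq≈-q : h * q ≈ - q
      hq≈-q = +-inverseˡ-unique _ _ (begin
        h * q + q         ≈⟨ +-congˡ (*-identityˡ q) ⟨
        h * q + 1# * q    ≈⟨ distribʳ q h 1# ⟨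
        g * q             ≈⟨ gq≈0 ⟩
        0#                ∎)

      -- The factor 1 - 2q changes `g ⋆ + q` into `g ⋆ - q`. Then h sends `g ⋆` to g and, being -1
      -- on the kernel of g, sends `- q` to `q`.
      g+q≈h[g+q]⋆[1-2q] : g + q ≈ h * ((g + q) ⋆ * (1# - (q + q)))
      g+q≈h[g+q]⋆[1-2q] = sym (begin
        h * ((g + q) ⋆ * (1# - (q + q)))      ≈⟨ *-congˡ (x[y-z]≈xy-xz _ 1# (q + q)) ⟩
        h * ((g + q) ⋆ * 1# - (g + q) ⋆ * (q + q))
                                               ≈⟨ *-congˡ (+-cong (trans (*-identityʳ _) G⋆≈) (-‿cong (trans (distribˡ _ q q) (+-cong G⋆q≈q G⋆q≈q)))) ⟩
        h * ((g ⋆ + q) - (q + q))              ≈⟨ *-congˡ (begin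
          (g ⋆ + q) - (q + q)                    ≈⟨ +-congˡ (-‿+-comm q q) ⟨
          (g ⋆ + q) + (- q + - q)                ≈⟨ +-assoc _ _ _ ⟨
          ((g ⋆ + q) - q) - q                    ≈⟨ +-congʳ ([x+y]-y _ q) ⟩
          g ⋆ - q                                ∎) ⟩
        h * (g ⋆ - q)                          ≈⟨ x[y-z]≈xy-xz h (g ⋆) q ⟩
        h * g ⋆ - h * q                        ≈⟨ +-cong hg⋆≈g (-‿cong hq≈-q) ⟩
        g - - q                                ≈⟨ +-congˡ (-‿involutive q) ⟩
        g + q                                  ∎)
        where
        G⋆≈ : (g + q) ⋆ ≈ g ⋆ + q
        G⋆≈ = trans (⋆-+ g q) (+-congˡ q⋆≈q)
        G⋆q≈q : (g + q) ⋆ * q ≈ q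
        G⋆q≈q = begin
          (g + q) ⋆ * q       ≈⟨ *-congʳ G⋆≈ ⟩
          (g ⋆ + q) * q       ≈⟨ distribʳ q _ q ⟩
          g ⋆ * q + q * q     ≈⟨ +-dropˡ g⋆q≈0 ⟩
          q * q               ≈⟨ qq≈q ⟩
          q                   ∎

      module _ (U : SkewUnit q) where
        open SkewUnit U

        ts≈q : t * s ≈ q
        ts≈q = begin
          t * s          ≈⟨ neg-*-neg t s ⟨
          - t * - s      ≈⟨ *-cong t⋆≈-t s⋆≈-s ⟨
          t ⋆ * s ⋆      ≈⟨ ⋆-* s t ⟨
          (s * t) ⋆      ≈⟨ ⋆-cong st≈q ⟩
          q ⋆            ≈⟨ q⋆≈q ⟩
          q              ∎

        [g+s][n+t]≈1 : (g + s) * (n + t) ≈ 1#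
        [g+s][n+t]≈1 = begin
          (g + s) * (n + t)                    ≈⟨ foil g s n t ⟩
          (g * n + g * t) + (s * n + s * t)    ≈⟨ +-cong (+-dropʳ (viaˡ qt≈t gq≈0)) (+-dropˡ (viaʳ (skew-absorbʳ q⋆≈q s⋆≈-s qs≈s) qn≈0)) ⟩
          g * n + s * t                        ≈⟨ +-cong gn≈p st≈q ⟩
          p + q                                ≈⟨ p+q≈1 ⟩
          1#                                   ∎

        [n+t][g+s]≈1 : (n + t) * (g + s) ≈ 1#
        [n+t][g+s]≈1 = begin
          (n + t) * (g + s)                    ≈⟨ foil n t g s ⟩
          (n * g + n * s) + (t * g + t * s)    ≈⟨ +-cong (+-dropʳ (viaˡ qs≈s nq≈0)) (+-dropˡ (viaʳ (skew-absorbʳ q⋆≈q t⋆≈-t qt≈t) qg≈0)) ⟩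
          n * g + t * s                        ≈⟨ +-cong ng≈p ts≈q ⟩
          p + q                                ≈⟨ p+q≈1 ⟩
          1#                                   ∎

        decomposition : Σ[ y ∈ Carrier ] Σ[ y⁻¹ ∈ Carrier ] (y⁻¹ * y ≈ 1# × y * y⁻¹ ≈ 1#) ×
          Σ[ z ∈ Carrier ] (y + y ⋆ ≈ z * - (z ⋆)) × (h ≈ - (1# - - (z ⋆) * y⁻¹ * z))
        -- The signs answer the minus sign in X′: `z * - (z ⋆)` equals - p, so `y` must be the
        -- negative of `n + t`, whose symmetric part is governed by `n⋆+n≈p` because the skew `t`
        -- cancels against its adjoint. In the second equation the two minus signs cancel, and
        -- cutting `g + s` down by `p` on both sides leaves g.
        decomposition = - (n + t) , - (g + s)
          , (trans (neg-*-neg _ _) [g+s][n+t]≈1 , trans (neg-*-neg _ _) [n+t][g+s]≈1)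
          , p , y+y⋆ , sym h≈
          where
          y+y⋆ : - (n + t) + (- (n + t)) ⋆ ≈ p * - (p ⋆)
          y+y⋆ = begin
            - (n + t) + (- (n + t)) ⋆      ≈⟨ +-congˡ (⋆-neg (n + t)) ⟩
            - (n + t) - (n + t) ⋆          ≈⟨ -‿+-comm _ _ ⟩
            - ((n + t) + (n + t) ⋆)        ≈⟨ -‿cong (begin
              (n + t) + (n + t) ⋆            ≈⟨ +-cong (+-comm n t) (⋆-+ n t) ⟩
              (t + n) + (n ⋆ + t ⋆)          ≈⟨ +-assoc t n _ ⟩
              t + (n + (n ⋆ + t ⋆))          ≈⟨ +-congˡ (+-assoc n _ _) ⟨
              t + ((n + n ⋆) + t ⋆)          ≈⟨ +-cong refl (+-cong (trans (+-comm n _) n⋆+n≈p) t⋆≈-t) ⟩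
              t + (p - t)                    ≈⟨ +-assoc t p (- t) ⟨
              (t + p) - t                    ≈⟨ +-congʳ (+-comm t p) ⟩
              (p + t) - t                    ≈⟨ [x+y]-y p t ⟩
              p                              ∎) ⟩
            - p                            ≈⟨ -‿cong (trans (*-congˡ p⋆≈p) pp≈p) ⟨
            - (p * p ⋆)                    ≈⟨ -‿distribʳ-* p _ ⟩
            p * - (p ⋆)                    ∎
          h≈ : - (1# - - (p ⋆) * - (g + s) * p) ≈ h
          h≈ = begin
            - (1# - - (p ⋆) * - (g + s) * p)    ≈⟨ -‿cong (+-congˡ (-‿cong (begin
              - (p ⋆) * - (g + s) * p             ≈⟨ *-congʳ (trans (neg-*-neg _ _) (*-congʳ p⋆≈p)) ⟩
              p * (g + s) * p                     ≈⟨ *-assoc _ _ _ ⟩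
              p * ((g + s) * p)                   ≈⟨ *-congˡ (distribʳ p g s) ⟩
              p * (g * p + s * p)                 ≈⟨ *-congˡ (+-cong ggx≈g (viaʳ (skew-absorbʳ q⋆≈q s⋆≈-s qs≈s) qp≈0)) ⟩
              p * (g + 0#)                        ≈⟨ *-congˡ (+-identityʳ g) ⟩
              p * g                               ≈⟨ pg≈g ⟩
              g                                   ∎))) ⟩
            - (1# - g)                          ≈⟨ -‿cong (+-congˡ (-‿+-comm h 1#)) ⟨
            - (1# + (- h - 1#))                 ≈⟨ -‿cong (+-comm 1# _) ⟩
            - ((- h - 1#) + 1#)                 ≈⟨ -‿cong (trans (+-assoc (- h) _ _) (+-dropʳ (-‿inverseˡ 1#))) ⟩
            - - h                               ≈⟨ -‿involutive h ⟩
            h                                   ∎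

-- The matrix ring and its involution `ε̃`.

module MatrixRing (R : CommutativeRing a ℓ) where
  open CommutativeRing R hiding (zero)
  open RingProperties ring
  open SemiringSum semiring
  open SetoidReasoning setoid
  open Matrices R

  ∑-cong : ∀ n {f g : Vector Carrier n} → (∀ i → f i ≈ g i) → sum f ≈ sum g
  ∑-cong n = sum-cong-≋

  sum-zero : ∀ {n} (f : Vector Carrier n) → (∀ i → f i ≈ 0#) → sum f ≈ 0#
  sum-zero {n} f f≈0 = trans (sum-cong-≋ f≈0) (sum-replicate-zero n)

  sum-single : ∀ {n} (f : Vector Carrier n) i → (∀ j → j ≢ i → f j ≈ 0#) → sum f ≈ f i
  sum-single f zero    f≈0 = trans (+-congˡ (sum-zero _ (λ j → f≈0 (suc j) λ ()))) (+-identityʳ _)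
  sum-single f (suc i) f≈0 =
    trans (+-cong (f≈0 zero λ ()) (sum-single (f ∘ suc) i (λ j j≢i → f≈0 (suc j) λ { ≡.refl → j≢i ≡.refl })))
          (+-identityˡ _)

  diagonal-≡ : ∀ {n} (d : Vector Carrier n) i → diagonal d i i ≈ d i
  diagonal-≡ d i with i ≟ i
  ... | yes _  = refl
  ... | no i≢i = contradiction ≡.refl i≢i

  diagonal-≢ : ∀ {n} (d : Vector Carrier n) {i j} → i ≢ j → diagonal d i j ≈ 0#
  diagonal-≢ d {i} {j} i≢j with i ≟ j
  ... | yes i≡j = contradiction i≡j i≢j
  ... | no _    = refl

  I-sym : ∀ {n} (i j : Fin n) → I i j ≈ I j i
  I-sym i j with i ≟ j
  ... | yes ≡.refl = sym (diagonal-≡ _ i)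
  ... | no i≢j     = sym (diagonal-≢ _ (i≢j ∘ ≡.sym))

  sum-diagonal-* : ∀ {n} (d f : Vector Carrier n) i → sum (λ k → diagonal d i k * f k) ≈ d i * f i
  sum-diagonal-* d f i =
    trans (sum-single _ i (λ j j≢i → trans (*-congʳ (diagonal-≢ d (j≢i ∘ ≡.sym))) (zeroˡ _)))
          (*-congʳ (diagonal-≡ d i))

  sum-I-* : ∀ {n} (f : Vector Carrier n) i → sum (λ k → I i k * f k) ≈ f i
  sum-I-* f i = trans (sum-diagonal-* _ f i) (*-identityˡ _)

  sum-*-I : ∀ {n} (f : Vector Carrier n) i → sum (λ k → f k * I k i) ≈ f i
  sum-*-I {n} f i = trans (∑-cong n (λ k → trans (*-comm _ _) (*-congʳ (I-sym k i)))) (sum-I-* f i)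

  -- Stated for a row, a rectangular matrix and a column, it serves the associativity of the
  -- product, the action on vectors and the adjunction for the form.
  sum-assoc : ∀ {m n} (x : Vector Carrier m) (A : Vector (Vector Carrier n) m) (y : Vector Carrier n) →
    sum (λ k → sum (λ l → x l * A l k) * y k) ≈ sum (λ l → x l * sum (λ k → A l k * y k))
  sum-assoc {m} {n} x A y = begin
    sum (λ k → sum (λ l → x l * A l k) * y k)    ≈⟨ ∑-cong n (λ k → *-distribʳ-sum {m} (y k) _) ⟩
    sum (λ k → sum (λ l → x l * A l k * y k))    ≈⟨ ∑-comm (λ k l → x l * A l k * y k) ⟩
    sum (λ l → sum (λ k → x l * A l k * y k))    ≈⟨ ∑-cong m (λ l → ∑-cong n (λ k → *-assoc _ _ _)) ⟩
    sum (λ l → sum (λ k → x l * (A l k * y k)))  ≈⟨ ∑-cong m (λ l → *-distribˡ-sum {n} (x l) _) ⟨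
    sum (λ l → x l * sum (λ k → A l k * y k))    ∎

  sum-neg : ∀ {n} (f : Vector Carrier n) → sum (λ i → - f i) ≈ - sum f
  sum-neg f = +-inverseʳ-unique _ _
    (trans (sym (∑-distrib-+ f _)) (sum-zero _ (λ i → -‿inverseʳ (f i))))

  matrixRing : ℕ → Ring a ℓ
  matrixRing n = record
    { Carrier = Matrix n
    ; _≈_ = _≈ᴹ_
    ; _+_ = _+ᴹ_
    ; _*_ = _*ᴹ_
    ; -_  = -ᴹ_
    ; 0#  = λ _ _ → 0#
    ; 1#  = I
    ; isRing = record
      { +-isAbelianGroup = record
        { isGroup = record
          { isMonoid = record
            { isSemigroup = record
              { isMagma = record
                { isEquivalence = record
                  { refl  = λ _ _ → refl
                  ; sym   = λ e i j → sym (e i j)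
                  ; trans = λ e f i j → trans (e i j) (f i j)
                  }
                ; ∙-cong = λ e f i j → +-cong (e i j) (f i j)
                }
              ; assoc = λ A B C i j → +-assoc _ _ _
              }
            ; identity = (λ A i j → +-identityˡ _) , (λ A i j → +-identityʳ _)
            }
          ; inverse = (λ A i j → -‿inverseˡ _) , (λ A i j → -‿inverseʳ _)
          ; ⁻¹-cong = λ e i j → -‿cong (e i j)
          }
        ; comm = λ A B i j → +-comm _ _
        }
      ; *-cong = λ e f i j → ∑-cong n (λ k → *-cong (e i k) (f k j))
      ; *-assoc = λ A B C i j → sum-assoc (A i) B (λ k → C k j)
      ; *-identity = (λ A i j → sum-I-* (λ k → A k j) i) , (λ A i j → sum-*-I (A i) j)
      ; distrib = (λ A B C i j → trans (∑-cong n (λ k → distribˡ _ _ _)) (∑-distrib-+ {n} _ _))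
                , (λ A B C i j → trans (∑-cong n (λ k → distribʳ _ _ _)) (∑-distrib-+ {n} _ _))
      }
    }

  module _ {n : ℕ} where
    private
      module M = Ring (matrixRing n)
      module MR = SetoidReasoning M.setoid

    w-sym : (i j : Fin n) → w i j ≈ w j i
    w-sym i j with i ≟ opposite j
    ... | yes ≡.refl = sym (trans (reflexive (≡.cong (I j) (opposite-involutive j))) (diagonal-≡ _ j))
    ... | no i≢oj    = sym (diagonal-≢ _ (λ j≡oi → i≢oj (≡.trans (≡.sym (opposite-involutive i)) (≡.cong opposite (≡.sym j≡oi)))))

    *w-entry : (A : Matrix n) (i j : Fin n) → (A *ᴹ w) i j ≈ A i (opposite j)
    *w-entry A i j = sum-*-I (A i) (opposite j)

    w*-entry : (A : Matrix n) (i j : Fin n) → (w *ᴹ A) i j ≈ A (opposite i) j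
    w*-entry A i j = trans (∑-cong n (λ k → *-congʳ (w-sym i k)))
      (trans (∑-cong n (λ k → *-congʳ (I-sym k (opposite i)))) (sum-I-* (λ k → A k j) (opposite i)))

    -- Conjugating the transpose by `w` reflects in the antidiagonal, so congruence, additivity and
    -- involutivity of `ε̃` can be read off from the entries.
    ε̃-entry : (A : Matrix n) (i j : Fin n) → ε̃ A i j ≈ A (opposite j) (opposite i)
    ε̃-entry A i j = trans (*w-entry (w *ᴹ transpose A) i j) (w*-entry (transpose A) i (opposite j))

    w*w≈I : w {n} *ᴹ w ≈ᴹ I
    w*w≈I i j = trans (*w-entry w i j) (reflexive (≡.cong (I i) (opposite-involutive j)))

    transpose-* : (A B : Matrix n) → transpose (A *ᴹ B) ≈ᴹ transpose B *ᴹ transpose A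
    transpose-* A B i j = ∑-cong n (λ k → *-comm _ _)

    ε̃-* : (A B : Matrix n) → ε̃ (A *ᴹ B) ≈ᴹ ε̃ B *ᴹ ε̃ A
    ε̃-* A B = MR.begin
      w M.* transpose (A M.* B) M.* w             MR.≈⟨ M.*-congʳ {w} (M.*-congˡ {w} (transpose-* A B)) ⟩
      w M.* (Bᵀ M.* Aᵀ) M.* w                     MR.≈⟨ M.*-congʳ {w} (M.*-congˡ {w} (M.*-congˡ {Bᵀ} (M.*-identityˡ Aᵀ))) ⟨
      w M.* (Bᵀ M.* (I M.* Aᵀ)) M.* w             MR.≈⟨ M.*-congʳ {w} (M.*-congˡ {w} (M.*-congˡ {Bᵀ} (M.*-congʳ {Aᵀ} w*w≈I))) ⟨
      w M.* (Bᵀ M.* (w M.* w M.* Aᵀ)) M.* w       MR.≈⟨ M.*-congʳ {w} (M.*-congˡ {w} (M.*-congˡ {Bᵀ} (M.*-assoc w w Aᵀ))) ⟩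
      w M.* (Bᵀ M.* (w M.* (w M.* Aᵀ))) M.* w     MR.≈⟨ M.*-congʳ {w} (M.*-assoc w Bᵀ _) ⟨
      w M.* Bᵀ M.* (w M.* (w M.* Aᵀ)) M.* w       MR.≈⟨ M.*-congʳ {w} (M.*-assoc (w M.* Bᵀ) w _) ⟨
      w M.* Bᵀ M.* w M.* (w M.* Aᵀ) M.* w         MR.≈⟨ M.*-assoc (w M.* Bᵀ M.* w) (w M.* Aᵀ) w ⟩
      w M.* Bᵀ M.* w M.* (w M.* Aᵀ M.* w)         MR.∎
      where
      Aᵀ = transpose A
      Bᵀ = transpose B

    ε̃-cong : {A B : Matrix n} → A ≈ᴹ B → ε̃ A ≈ᴹ ε̃ B
    ε̃-cong A≈B i j = trans (ε̃-entry _ i j) (trans (A≈B _ _) (sym (ε̃-entry _ i j)))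

    ε̃-isInvolution : IsInvolution (matrixRing n) ε̃
    ε̃-isInvolution = record
      { ⋆-cong = λ {A} {B} → ε̃-cong {A} {B}
      ; ⋆-+ = λ A B i j → trans (ε̃-entry (A +ᴹ B) i j) (+-cong (sym (ε̃-entry A i j)) (sym (ε̃-entry B i j)))
      ; ⋆-* = ε̃-*
      ; ⋆-involutive = λ A i j → trans (ε̃-entry (ε̃ A) i j) (trans (ε̃-entry A _ _)
          (reflexive (≡.cong₂ A (opposite-involutive i) (opposite-involutive j))))
      }

-- Alternating forms of the rows, and their uniqueness.

module Determinant (R : CommutativeRing a ℓ) where
  open CommutativeRing R hiding (zero)
  open RingProperties ring
  open CommutativeSemigroupProperties *-commutativeSemigroup using () renaming (x∙yz≈y∙xz to x*yz≈y*xz)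
  open CommutativeSemigroupProperties +-commutativeSemigroup using () renaming (x∙yz≈y∙xz to x+yz≈y+xz)
  open SemiringSum semiring
  open RawSemiringDefinitions (Semiring.rawSemiring semiring) using (_^_)
  open SetoidReasoning setoid
  open Matrices R
  open MatrixRing R

  private
    variable
      m n : ℕ

  -- Rectangular, because fixing the first row of an alternating form leaves a form in fewer rows of
  -- the same length, and the inductions go through such forms.
  Rows : ℕ → ℕ → Set a
  Rows m n = Vector (Vector Carrier n) m

  infix 4 _≈ᴿ_
  _≈ᴿ_ : Rows m n → Rows m n → Set ℓ
  A ≈ᴿ B = ∀ i k → A i k ≈ B i k

  ≡⇒≈ᴿ : {A B : Rows m n} → (∀ i → A i ≡ B i) → A ≈ᴿ B
  ≡⇒≈ᴿ A≡B i k = reflexive (≡.cong (λ x → x k) (A≡B i))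

  infixl 7 _[_≔_]
  _[_≔_] : Rows m n → Fin m → Vector Carrier n → Rows m n
  A [ i ≔ x ] = updateAt A i (λ _ → x)

  ≔-cong : (A : Rows m n) (i : Fin m) {x y : Vector Carrier n} →
    (∀ k → x k ≈ y k) → A [ i ≔ x ] ≈ᴿ A [ i ≔ y ]
  ≔-cong A zero    x≈y zero    = x≈y
  ≔-cong A zero    x≈y (suc j) = λ _ → refl
  ≔-cong A (suc i) x≈y zero    = λ _ → refl
  ≔-cong A (suc i) x≈y (suc j) = ≔-cong (tail A) i x≈y j

  ≔-self : (A : Rows m n) (i : Fin m) {x : Vector Carrier n} →
    (∀ k → x k ≈ A i k) → A [ i ≔ x ] ≈ᴿ A
  ≔-self A zero    x≈Ai zero    = x≈Ai
  ≔-self A zero    x≈Ai (suc j) = λ _ → refl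
  ≔-self A (suc i) x≈Ai zero    = λ _ → refl
  ≔-self A (suc i) x≈Ai (suc j) = ≔-self (tail A) i x≈Ai j

  ◂-≔ : (x : Vector Carrier n) (A : Rows m n) (i : Fin m) (y : Vector Carrier n) →
    (x ◂ A) [ suc i ≔ y ] ≈ᴿ x ◂ (A [ i ≔ y ])
  ◂-≔ x A i y zero    k = refl
  ◂-≔ x A i y (suc j) k = refl

  ◂-cong : (x : Vector Carrier n) {A B : Rows m n} → A ≈ᴿ B → x ◂ A ≈ᴿ x ◂ B
  ◂-cong x A≈B zero    k = refl
  ◂-cong x A≈B (suc i) k = A≈B i k

  map-≔ : ∀ {n′} (T : Vector Carrier n → Vector Carrier n′) (A : Rows m n) (i : Fin m) (x : Vector Carrier n) →
    T ∘ (A [ i ≔ x ]) ≈ᴿ (T ∘ A) [ i ≔ T x ]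
  map-≔ T A zero    x zero    k = refl
  map-≔ T A zero    x (suc j) k = refl
  map-≔ T A (suc i) x zero    k = refl
  map-≔ T A (suc i) x (suc j) k = map-≔ T (tail A) i x j k

  ≔-updates : (A : Rows m n) (i : Fin m) (x : Vector Carrier n) → ∀ k → (A [ i ≔ x ]) i k ≈ x k
  ≔-updates A i x k = reflexive (≡.cong (λ v → v k) (updateAt-updates i A))

  ≔-minimal : (A : Rows m n) {i j : Fin m} (x : Vector Carrier n) → i ≢ j → ∀ k → (A [ j ≔ x ]) i k ≈ A i k
  ≔-minimal A {i} {j} x i≢j k = reflexive (≡.cong (λ v → v k) (updateAt-minimal i j A i≢j))

  record Multilinear (D : Rows m n → Carrier) : Set (a ⊔ ℓ) where
    field
      cong   : ∀ {A B} → A ≈ᴿ B → D A ≈ D B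
      linear : ∀ A i s x y →
        D (A [ i ≔ (λ k → s * x k + y k) ]) ≈ s * D (A [ i ≔ x ]) + D (A [ i ≔ y ])

    additive : ∀ A i x y → D (A [ i ≔ (λ k → x k + y k) ]) ≈ D (A [ i ≔ x ]) + D (A [ i ≔ y ])
    additive A i x y = begin
      D (A [ i ≔ (λ k → x k + y k) ])                ≈⟨ cong (≔-cong A i (λ k → +-congʳ (*-identityˡ (x k)))) ⟨
      D (A [ i ≔ (λ k → 1# * x k + y k) ])           ≈⟨ linear A i 1# x y ⟩
      1# * D (A [ i ≔ x ]) + D (A [ i ≔ y ])         ≈⟨ +-congʳ (*-identityˡ _) ⟩
      D (A [ i ≔ x ]) + D (A [ i ≔ y ])              ∎

    zero-row : ∀ A i → D (A [ i ≔ (λ _ → 0#) ]) ≈ 0#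
    zero-row A i = x+x≈x⇒x≈0 _ (trans (sym (additive A i _ _)) (cong (≔-cong A i (λ _ → +-identityˡ 0#))))

    linear-sum : ∀ {p} A i (c : Vector Carrier p) (X : Rows p n) →
      D (A [ i ≔ (λ k → sum (λ l → c l * X l k)) ]) ≈ sum (λ l → c l * D (A [ i ≔ X l ]))
    linear-sum {ℕ.zero}  A i c X = zero-row A i
    linear-sum {ℕ.suc p} A i c X =
      trans (linear A i (c zero) (X zero) _) (+-congˡ (linear-sum A i (c ∘ suc) (X ∘ suc)))

    ≔-swap : ∀ A {i j} x y → i ≢ j → D (A [ i ≔ x ] [ j ≔ y ]) ≈ D (A [ j ≔ y ] [ i ≔ x ])
    ≔-swap A {i} {j} x y i≢j = cong (≡⇒≈ᴿ (updateAt-commutes j i (i≢j ∘ ≡.sym) A))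

    -- Polarisation at x + y. The vanishing is asked for the two slots `i` and `j` of one family, so
    -- that the lemma can serve inside the induction which proves `det` alternating.
    antisymmetric : ∀ A {i j} → i ≢ j → (∀ x → D (A [ i ≔ x ] [ j ≔ x ]) ≈ 0#) →
      ∀ x y → D (A [ i ≔ x ] [ j ≔ y ]) ≈ - D (A [ i ≔ y ] [ j ≔ x ])
    antisymmetric A {i} {j} i≢j f[x,x]≈0 x y = +-inverseˡ-unique _ _ (sym (begin
      0#                                   ≈⟨ f[x,x]≈0 x+y ⟨
      f x+y x+y                            ≈⟨ additive (A [ i ≔ x+y ]) j x y ⟩
      f x+y x + f x+y y                    ≈⟨ +-cong (additiveˡ x) (additiveˡ y) ⟩
      (f x x + f y x) + (f x y + f y y)    ≈⟨ +-cong (+-congʳ (f[x,x]≈0 x)) (+-congˡ (f[x,x]≈0 y)) ⟩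
      (0# + f y x) + (f x y + 0#)          ≈⟨ +-cong (+-identityˡ _) (+-identityʳ _) ⟩
      f y x + f x y                        ≈⟨ +-comm _ _ ⟩
      f x y + f y x                        ∎))
      where
      f : Vector Carrier n → Vector Carrier n → Carrier
      f u v = D (A [ i ≔ u ] [ j ≔ v ])
      x+y : Vector Carrier n
      x+y k = x k + y k
      additiveˡ : ∀ z → f x+y z ≈ f x z + f y z
      additiveˡ z = trans (≔-swap A x+y z i≢j) (trans (additive (A [ j ≔ z ]) i x y)
        (sym (+-cong (≔-swap A x z i≢j) (≔-swap A y z i≢j))))

  record Alternating (D : Rows m n → Carrier) : Set (a ⊔ ℓ) where
    field
      multilinear : Multilinear D
      alternating : ∀ A {i j} → i ≢ j → (∀ k → A i k ≈ A j k) → D A ≈ 0#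
    open Multilinear multilinear public

  -- Applied to every row of a family; the instances are right multiplication by a matrix and the
  -- insertion or deletion of a column.
  record LinearMap {n n′} (T : Vector Carrier n → Vector Carrier n′) : Set (a ⊔ ℓ) where
    field
      map-cong   : ∀ {x y} → (∀ k → x k ≈ y k) → ∀ k → T x k ≈ T y k
      map-linear : ∀ s x y k → T (λ l → s * x l + y l) k ≈ s * T x k + T y k

  multilinear-∘ : ∀ {n′} {D : Rows m n′ → Carrier} {T : Vector Carrier n → Vector Carrier n′} →
    Multilinear D → LinearMap T → Multilinear (λ A → D (T ∘ A))
  multilinear-∘ {D = D} {T} mul lin = record
    { cong   = λ A≈B → cong (λ i → map-cong (A≈B i))
    ; linear = λ A i s x y → begin
        D (T ∘ (A [ i ≔ (λ k → s * x k + y k) ]))            ≈⟨ cong (map-≔ T A i _) ⟩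
        D ((T ∘ A) [ i ≔ T (λ k → s * x k + y k) ])          ≈⟨ cong (≔-cong (T ∘ A) i (map-linear s x y)) ⟩
        D ((T ∘ A) [ i ≔ (λ k → s * T x k + T y k) ])        ≈⟨ linear (T ∘ A) i s (T x) (T y) ⟩
        s * D ((T ∘ A) [ i ≔ T x ]) + D ((T ∘ A) [ i ≔ T y ])
          ≈⟨ +-cong (*-congˡ (cong (map-≔ T A i x))) (cong (map-≔ T A i y)) ⟨
        s * D (T ∘ (A [ i ≔ x ])) + D (T ∘ (A [ i ≔ y ]))    ∎
    }
    where open Multilinear mul
          open LinearMap lin

  alternating-∘ : ∀ {n′} {D : Rows m n′ → Carrier} {T : Vector Carrier n → Vector Carrier n′} →
    Alternating D → LinearMap T → Alternating (λ A → D (T ∘ A))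
  alternating-∘ {T = T} alt lin = record
    { multilinear = multilinear-∘ multilinear lin
    ; alternating = λ A i≢j Ai≈Aj → alternating (T ∘ A) i≢j (map-cong Ai≈Aj)
    }
    where open Alternating alt
          open LinearMap lin

  alternating-◂ : ∀ {D : Rows (suc m) n → Carrier} (x : Vector Carrier n) →
    Alternating D → Alternating (λ A → D (x ◂ A))
  alternating-◂ {D = D} x alt = record
    { multilinear = record
      { cong   = λ A≈B → cong (◂-cong x A≈B)
      ; linear = λ A i s y z → begin
          D (x ◂ (A [ i ≔ (λ k → s * y k + z k) ]))                      ≈⟨ cong (◂-≔ x A i _) ⟨
          D ((x ◂ A) [ suc i ≔ (λ k → s * y k + z k) ])                  ≈⟨ linear (x ◂ A) (suc i) s y z ⟩
          s * D ((x ◂ A) [ suc i ≔ y ]) + D ((x ◂ A) [ suc i ≔ z ])      ≈⟨ +-cong (*-congˡ (cong (◂-≔ x A i y))) (cong (◂-≔ x A i z)) ⟩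
          s * D (x ◂ (A [ i ≔ y ])) + D (x ◂ (A [ i ≔ z ]))              ∎
      }
    ; alternating = λ A i≢j → alternating (x ◂ A) (i≢j ∘ suc-injective)
    }
    where open Alternating alt

  -- A term of the multilinear expansion that has `y` in two rows vanishes, so the expansion stops
  -- at first order. It serves to clear a column below a unit row and to compute determinants of
  -- reflections.
  rank-one : {D : Rows m n → Carrier} → Alternating D → ∀ A (x : Vector Carrier m) (y : Vector Carrier n) →
    D (λ i k → A i k + x i * y k) ≈ D A + sum (λ i → x i * D (A [ i ≔ y ]))
  rank-one {ℕ.zero} {D = D} alt A x y = trans (Alternating.cong alt (λ ())) (sym (+-identityʳ _))
  rank-one {ℕ.suc m} {n} {D} alt A x y = begin
    D (λ i k → A i k + x i * y k)
      ≈⟨ cong (λ { zero k → +-comm _ _ ; (suc i) k → refl }) ⟩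
    D (B [ zero ≔ (λ k → x zero * y k + A zero k) ])
      ≈⟨ linear B zero (x zero) y (A zero) ⟩
    x zero * D (B [ zero ≔ y ]) + D (B [ zero ≔ A zero ])
      ≈⟨ +-cong (*-congˡ (trans (cong (≔-◂ B y)) (rank-one (alternating-◂ y alt) (tail A) (x ∘ suc) y)))
                (trans (cong (≔-◂ B (A zero))) (rank-one (alternating-◂ (A zero) alt) (tail A) (x ∘ suc) y)) ⟩
    x zero * (D (y ◂ tail A) + sum (λ i → x (suc i) * D (y ◂ (tail A [ i ≔ y ]))))
      + (D (A zero ◂ tail A) + sum (λ i → x (suc i) * D (A zero ◂ (tail A [ i ≔ y ]))))
      ≈⟨ +-cong (*-congˡ (trans (+-congˡ (sum-zero _ repeated)) (+-identityʳ _)))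
                (+-cong (cong (λ { zero k → refl ; (suc i) k → refl }))
                        (∑-cong m (λ i → *-congˡ (cong (λ { zero k → refl ; (suc j) k → refl }))))) ⟩
    x zero * D (y ◂ tail A) + (D A + sum (λ i → x (suc i) * D (A [ suc i ≔ y ])))
      ≈⟨ x+yz≈y+xz _ _ _ ⟩
    D A + (x zero * D (y ◂ tail A) + sum (λ i → x (suc i) * D (A [ suc i ≔ y ])))
      ≈⟨ +-congˡ (+-congʳ (*-congˡ (cong (λ { zero k → refl ; (suc i) k → refl })))) ⟩
    D A + sum (λ i → x i * D (A [ i ≔ y ])) ∎
    where
    open Alternating alt
    B : Rows (ℕ.suc m) n
    B i k = A i k + x i * y k
    ≔-◂ : ∀ (B : Rows (ℕ.suc m) n) z → B [ zero ≔ z ] ≈ᴿ z ◂ tail B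
    ≔-◂ B z zero    k = refl
    ≔-◂ B z (suc i) k = refl
    repeated : ∀ i → x (suc i) * D (y ◂ (tail A [ i ≔ y ])) ≈ 0#
    repeated i = trans (*-congˡ (alternating (y ◂ (tail A [ i ≔ y ])) {zero} {suc i} (λ ())
      (λ k → sym (≔-updates (tail A) i y k)))) (zeroʳ _)

  sgn : Fin n → Carrier
  sgn j = (- 1#) ^ toℕ j

  sgn-suc : (j : Fin n) → sgn (suc j) ≈ - sgn j
  sgn-suc j = trans (sym (-‿distribˡ-* 1# (sgn j))) (-‿cong (*-identityˡ _))

  -- Induction on `j`: moving the row to the top of the tail costs `sgn j`, and one exchange with
  -- the first row supplies the last sign.
  cycle : {D : Rows (suc m) n → Carrier} → Alternating D → ∀ X j →
    D (X j ◂ removeAt X j) ≈ sgn j * D X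
  cycle {D = D} alt X zero = trans (Alternating.cong alt (λ { zero k → refl ; (suc i) k → refl })) (sym (*-identityˡ _))
  cycle {ℕ.suc m} {n} {D} alt X (suc j) = begin
    D (X (suc j) ◂ removeAt X (suc j))      ≈⟨ cong (λ { zero k → refl ; (suc zero) k → refl ; (suc (suc i)) k → refl }) ⟩
    D (B [ zero ≔ X (suc j) ] [ suc zero ≔ X zero ])
      ≈⟨ antisymmetric B {zero} {suc zero} (λ ()) (λ x → alternating (B [ zero ≔ x ] [ suc zero ≔ x ]) {zero} {suc zero} (λ ()) (λ _ → refl)) (X (suc j)) (X zero) ⟩
    - D (B [ zero ≔ X zero ] [ suc zero ≔ X (suc j) ])
      ≈⟨ -‿cong (cong (λ { zero k → refl ; (suc zero) k → refl ; (suc (suc i)) k → refl })) ⟩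
    - D (X zero ◂ (X (suc j) ◂ removeAt (tail X) j))      ≈⟨ -‿cong (cycle (alternating-◂ (X zero) alt) (tail X) j) ⟩
    - (sgn j * D (X zero ◂ tail X))         ≈⟨ -‿distribˡ-* _ _ ⟩
    - sgn j * D (X zero ◂ tail X)           ≈⟨ *-cong (sym (sgn-suc j)) (cong (λ { zero k → refl ; (suc i) k → refl })) ⟩
    sgn (suc j) * D X                       ∎
    where
    open Alternating alt
    B : Rows (ℕ.suc (ℕ.suc m)) n
    B = X (suc j) ◂ removeAt X (suc j)

  minor : Matrix (suc n) → Fin (suc n) → Matrix n
  minor A j i = removeAt (A (suc i)) j

  laplaceTerm : Matrix (suc n) → Fin (suc n) → Carrier
  laplaceTerm A j = sgn j * (A zero j * det (minor A j))

  insertAt-linear : (j : Fin (suc n)) → LinearMap (λ v → insertAt v j 0#)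
  insertAt-linear j = record { map-cong = ins-cong j ; map-linear = ins-linear j }
    where
    ins-cong : ∀ {n} (j : Fin (suc n)) {x y : Vector Carrier n} → (∀ k → x k ≈ y k) →
      ∀ k → insertAt x j 0# k ≈ insertAt y j 0# k
    ins-cong zero x≈y zero = refl
    ins-cong zero x≈y (suc k) = x≈y k
    ins-cong {ℕ.suc n} (suc j) x≈y zero = x≈y zero
    ins-cong {ℕ.suc n} (suc j) x≈y (suc k) = ins-cong j (x≈y ∘ suc) k
    ins-linear : ∀ {n} (j : Fin (suc n)) s (x y : Vector Carrier n) k →
      insertAt (λ l → s * x l + y l) j 0# k ≈ s * insertAt x j 0# k + insertAt y j 0# k
    ins-linear zero s x y zero = sym (trans (+-identityʳ _) (zeroʳ s))
    ins-linear zero s x y (suc k) = refl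
    ins-linear {ℕ.suc n} (suc j) s x y zero = refl
    ins-linear {ℕ.suc n} (suc j) s x y (suc k) = ins-linear j s (tail x) (tail y) k

  insertAt-elim : ∀ (v : Vector Carrier n) (j : Fin (suc n)) (x : Vector Carrier (suc n)) →
    x j ≈ 0# → (∀ k → v k ≈ x (punchIn j k)) → ∀ k → insertAt v j 0# k ≈ x k
  insertAt-elim v j x xj≈0 v≈x k with j ≟ k
  ... | yes ≡.refl = trans (reflexive (insertAt-lookup v j 0#)) (sym xj≈0)
  ... | no j≢k     = begin
    insertAt v j 0# k                            ≡⟨ ≡.cong (insertAt v j 0#) (punchIn-punchOut j≢k) ⟨
    insertAt v j 0# (punchIn j (punchOut j≢k))   ≡⟨ insertAt-punchIn v j 0# (punchOut j≢k) ⟩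
    v (punchOut j≢k)                             ≈⟨ v≈x (punchOut j≢k) ⟩
    x (punchIn j (punchOut j≢k))                 ≡⟨ ≡.cong x (punchIn-punchOut j≢k) ⟩
    x k                                          ∎

  I-injective : ∀ {n′} (f : Fin n → Fin n′) → (∀ {i j} → f i ≡ f j → i ≡ j) → ∀ i j → I i j ≈ I (f i) (f j)
  I-injective f f-inj i j with i ≟ j
  ... | yes ≡.refl = sym (diagonal-≡ _ (f i))
  ... | no i≢j     = sym (diagonal-≢ _ (i≢j ∘ f-inj))

  -- A matrix with first row e_j may have the rest of its j-th column cleared,
  -- which reduces D to an alternating form of the minor.
  alternating-unique : {D : Matrix n → Carrier} → Alternating D → ∀ A → D A ≈ det A * D I
  alternating-unique {ℕ.zero} alt A = trans (Alternating.cong alt (λ ())) (sym (*-identityˡ _))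
  alternating-unique {ℕ.suc n} {D} alt A = begin
    D A
      ≈⟨ cong (≔-self A zero (sum-*-I (A zero))) ⟨
    D (A [ zero ≔ (λ k → sum (λ j → A zero j * I j k)) ])
      ≈⟨ linear-sum A zero (A zero) I ⟩
    sum (λ j → A zero j * D (A [ zero ≔ I j ]))
      ≈⟨ ∑-cong (ℕ.suc n) (λ j → trans (*-congˡ (trans (clear j) (trans (alternating-unique (Dⱼ-alternating j) (minor A j)) (*-congˡ (Dⱼ-I j)))))
           (reorder j)) ⟩
    sum (λ j → sgn j * (A zero j * det (minor A j)) * D I)
      ≈⟨ *-distribʳ-sum (D I) (laplaceTerm A) ⟨
    det A * D I ∎
    where
    open Alternating alt
    Dⱼ : Fin (ℕ.suc n) → Matrix n → Carrier
    Dⱼ j C = D (I j ◂ (λ i → insertAt (C i) j 0#))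
    Dⱼ-alternating : ∀ j → Alternating (Dⱼ j)
    Dⱼ-alternating j = alternating-∘ (alternating-◂ (I j) alt) (insertAt-linear j)
    Dⱼ-I : ∀ j → Dⱼ j I ≈ sgn j * D I
    Dⱼ-I j = trans (cong (◂-cong (I j) (λ i → insertAt-elim (I i) j (I (punchIn j i)) (diagonal-≢ _ (punchInᵢ≢i j i)) (I-injective (punchIn j) (punchIn-injective j _ _) i))))
                   (cycle alt I j)
    clear : ∀ j → D (A [ zero ≔ I j ]) ≈ Dⱼ j (minor A j)
    clear j = begin
      D (A [ zero ≔ I j ])
        ≈⟨ cong (λ { zero k → refl ; (suc i) k → split i k }) ⟩
      D (I j ◂ (λ i k → Z i k + A (suc i) j * I j k))
        ≈⟨ rank-one (alternating-◂ (I j) alt) Z (λ i → A (suc i) j) (I j) ⟩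
      D (I j ◂ Z) + sum (λ i → A (suc i) j * D (I j ◂ (Z [ i ≔ I j ])))
        ≈⟨ +-congˡ (sum-zero _ (λ i → trans (*-congˡ (alternating (I j ◂ (Z [ i ≔ I j ])) {zero} {suc i} (λ ()) (λ k → sym (≔-updates Z i (I j) k)))) (zeroʳ _))) ⟩
      D (I j ◂ Z) + 0#
        ≈⟨ +-identityʳ _ ⟩
      D (I j ◂ Z) ∎
      where
      Z : Rows n (ℕ.suc n)
      Z i = insertAt (minor A j i) j 0#
      split : ∀ i k → A (suc i) k ≈ Z i k + A (suc i) j * I j k
      split i k = sym (trans (+-congʳ (insertAt-elim (minor A j i) j (λ l → A (suc i) l - A (suc i) j * I j l)
        (trans (+-congˡ (-‿cong (trans (*-congˡ (diagonal-≡ _ j)) (*-identityʳ _)))) (-‿inverseʳ _))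
        (λ l → sym (trans (+-congˡ (trans (-‿cong (trans (*-congˡ (diagonal-≢ _ (punchInᵢ≢i j l ∘ ≡.sym))) (zeroʳ _))) -0#≈0#)) (+-identityʳ _))) k))
        (trans (+-assoc _ _ _) (trans (+-congˡ (-‿inverseˡ _)) (+-identityʳ _))))
    reorder : ∀ j → A zero j * (det (minor A j) * (sgn j * D I)) ≈ sgn j * (A zero j * det (minor A j)) * D I
    reorder j = trans (sym (*-assoc _ _ _)) (trans (sym (*-assoc _ _ _)) (*-congʳ (*-comm _ _)))

  -- The first-row expansion is an alternating form.

  det-cong : {A B : Matrix n} → A ≈ᴿ B → det A ≈ det B
  det-cong {ℕ.zero}  A≈B = refl
  det-cong {ℕ.suc n} {A} {B} A≈B = ∑-cong (ℕ.suc n) {laplaceTerm A} {laplaceTerm B} (λ j → *-congˡ {sgn j} (*-cong (A≈B zero j)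
    (det-cong (λ i k → A≈B (suc i) (punchIn j k)))))

  removeAt-linear : (j : Fin (suc n)) → LinearMap {suc n} {n} (λ v → removeAt v j)
  removeAt-linear j = record { map-cong = λ x≈y k → x≈y (punchIn j k) ; map-linear = λ s x y k → refl }

  det-multilinear : Multilinear (det {n})
  det-multilinear {ℕ.zero} = record { cong = det-cong ; linear = λ _ () }
  det-multilinear {ℕ.suc n} = record { cong = det-cong ; linear = lin }
    where
    combine : ∀ {N} (s : Carrier) (f g h : Vector Carrier N) → (∀ j → f j ≈ s * g j + h j) →
      sum f ≈ s * sum g + sum h
    combine {N} s f g h f≈ = trans (∑-cong N f≈) (trans (∑-distrib-+ {N} _ _) (+-congʳ (sym (*-distribˡ-sum {N} s g))))
    lin : ∀ A i s x y → det (A [ i ≔ (λ k → s * x k + y k) ]) ≈ s * det (A [ i ≔ x ]) + det (A [ i ≔ y ])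
    lin A zero s x y = combine {ℕ.suc n} s _ _ _ λ j → begin
      sgn j * ((s * x j + y j) * det (minor A j))    ≈⟨ *-congˡ (trans (distribʳ _ _ _) (+-congʳ (*-assoc _ _ _))) ⟩
      sgn j * (s * (x j * det (minor A j)) + y j * det (minor A j))      ≈⟨ distribˡ _ _ _ ⟩
      sgn j * (s * (x j * det (minor A j))) + sgn j * (y j * det (minor A j))    ≈⟨ +-congʳ (x*yz≈y*xz _ _ _) ⟩
      s * (sgn j * (x j * det (minor A j))) + sgn j * (y j * det (minor A j))    ∎
    lin A (suc i) s x y = combine {ℕ.suc n} s _ _ _ λ j → begin
      sgn j * (A zero j * det (minor (A [ suc i ≔ (λ k → s * x k + y k) ]) j))
        ≈⟨ *-congˡ (*-congˡ (Multilinear.linear (multilinear-∘ det-multilinear (removeAt-linear j)) (tail A) i s x y)) ⟩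
      sgn j * (A zero j * (s * det (minor (A [ suc i ≔ x ]) j) + det (minor (A [ suc i ≔ y ]) j)))
        ≈⟨ *-congˡ (trans (distribˡ _ _ _) (+-congʳ (x*yz≈y*xz _ _ _))) ⟩
      sgn j * (s * (A zero j * det (minor (A [ suc i ≔ x ]) j)) + A zero j * det (minor (A [ suc i ≔ y ]) j))
        ≈⟨ trans (distribˡ _ _ _) (+-congʳ (x*yz≈y*xz _ _ _)) ⟩
      s * (sgn j * (A zero j * det (minor (A [ suc i ≔ x ]) j))) + sgn j * (A zero j * det (minor (A [ suc i ≔ y ]) j)) ∎

  -- The symmetry of a doubly indexed family under exchanging the two distinct
  -- columns j and punchIn j k.
  ExchangeSymmetric : (Fin (suc n) → Fin n → Carrier) → Set ℓ
  ExchangeSymmetric {ℕ.zero}  c = ⊤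
  ExchangeSymmetric {ℕ.suc n} c =
    (∀ k → c zero k ≈ c (suc k) zero) × ExchangeSymmetric (λ j k → c (suc j) (suc k))

  -- The terms with `j` zero cancel those with `k` zero, because `sgn (suc j)` is the opposite of
  -- `sgn j`. In what remains both indices are shifted, the two sign changes cancel, and the sum has
  -- the same shape one size smaller.
  signed-sum-zero : (c : Fin (suc n) → Fin n → Carrier) → ExchangeSymmetric c →
    sum (λ j → sgn j * sum (λ k → sgn k * c j k)) ≈ 0#
  signed-sum-zero {ℕ.zero} c _ = trans (+-identityʳ _) (zeroʳ _)
  signed-sum-zero {ℕ.suc n} c (c₀ , c₊) = begin
    1# * sum (λ k → sgn k * c zero k) + sum (λ j → sgn (suc j) * (1# * c (suc j) zero + sum (λ k → sgn (suc k) * c (suc j) (suc k))))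
      ≈⟨ +-cong (trans (*-identityˡ _) (∑-cong (ℕ.suc n) (λ k → *-congˡ {sgn k} (c₀ k)))) (∑-cong (ℕ.suc n) step) ⟩
    sum f + sum (λ j → - f j + g j)        ≈⟨ +-congˡ (∑-distrib-+ (λ j → - f j) g) ⟩
    sum f + (sum (λ j → - f j) + sum g)    ≈⟨ +-congˡ (+-cong (sum-neg f) (signed-sum-zero (λ j k → c (suc j) (suc k)) c₊)) ⟩
    sum f + (- sum f + 0#)                 ≈⟨ +-congˡ (+-identityʳ _) ⟩
    sum f - sum f                          ≈⟨ -‿inverseʳ (sum f) ⟩
    0#                                     ∎
    where
    f g : Fin (ℕ.suc n) → Carrier
    f j = sgn j * c (suc j) zero
    g j = sgn j * sum (λ k → sgn k * c (suc j) (suc k))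
    step : ∀ j → sgn (suc j) * (1# * c (suc j) zero + sum (λ k → sgn (suc k) * c (suc j) (suc k)))
               ≈ - f j + g j
    step j = trans (distribˡ _ _ _) (+-cong
      (trans (*-cong (sgn-suc j) (*-identityˡ _)) (sym (-‿distribˡ-* _ _)))
      (trans (*-cong (sgn-suc j) (trans (∑-cong n (λ k → trans (*-congʳ (sgn-suc k)) (sym (-‿distribˡ-* _ _)))) (sum-neg {n} _)))
             (RingLemmas.neg-*-neg ring _ _)))

  lift : ∀ {p q} → (Fin p → Fin q) → Fin (suc p) → Fin (suc q)
  lift ρ zero    = zero
  lift ρ (suc i) = suc (ρ i)

  symmetric-cong : {c d : Fin (suc n) → Fin n → Carrier} → (∀ j k → c j k ≈ d j k) →
    ExchangeSymmetric c → ExchangeSymmetric d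
  symmetric-cong {ℕ.zero}  c≈d _         = tt
  symmetric-cong {ℕ.suc n} c≈d (c₀ , c₊) =
    (λ k → trans (sym (c≈d zero k)) (trans (c₀ k) (c≈d (suc k) zero))) , symmetric-cong (λ j k → c≈d (suc j) (suc k)) c₊

  -- `N` takes the embedding of the surviving columns rather than the pair of deleted ones: deleting
  -- two columns in either order gives pointwise the same embedding, which is the symmetry wanted.
  exchangeTerm : Vector Carrier (suc (suc n)) → ((Fin n → Fin (suc (suc n))) → Carrier) →
    Fin (suc (suc n)) → Fin (suc n) → Carrier
  exchangeTerm x N j k = x j * (x (punchIn j k) * N (punchIn j ∘ punchIn k))

  exchangeTerm-symmetric : (x : Vector Carrier (suc (suc n))) (N : (Fin n → Fin (suc (suc n))) → Carrier) →
    (∀ ρ σ → (∀ i → ρ i ≡ σ i) → N ρ ≈ N σ) → ExchangeSymmetric (exchangeTerm x N)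
  exchangeTerm-symmetric {ℕ.zero}  x N N-cong =
    (λ k → trans (*-congˡ (*-congˡ (N-cong _ _ λ ()))) (x*yz≈y*xz _ _ _)) , tt
  exchangeTerm-symmetric {ℕ.suc n} x N N-cong =
    (λ k → trans (*-congˡ (*-congˡ (N-cong _ _ λ _ → ≡.refl))) (x*yz≈y*xz _ _ _))
    , symmetric-cong {c = exchangeTerm (x ∘ suc) (N ∘ lift)}
        (λ j k → *-congˡ (*-congˡ (N-cong (lift (punchIn j ∘ punchIn k)) (punchIn (suc j) ∘ punchIn (suc k))
          λ { zero → ≡.refl ; (suc i) → ≡.refl })))
        (exchangeTerm-symmetric (x ∘ suc) (N ∘ lift) (λ ρ σ ρ≡σ → N-cong _ _ λ { zero → ≡.refl ; (suc i) → ≡.cong suc (ρ≡σ i) }))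

  -- Expanding along two rows gives a signed sum over ordered pairs of distinct columns. When the
  -- rows agree, the unsigned terms are symmetric in the pair and `signed-sum-zero` applies.
  det-alternating₀₁ : (A : Matrix (suc (suc n))) → (∀ k → A zero k ≈ A (suc zero) k) → det A ≈ 0#
  det-alternating₀₁ {n} A A₀≈A₁ = begin
    sum (λ j → sgn j * (A zero j * sum (λ k → sgn k * (A (suc zero) (punchIn j k) * N (punchIn j ∘ punchIn k)))))
      ≈⟨ ∑-cong (ℕ.suc (ℕ.suc n)) (λ j → *-congˡ {sgn j} (*-distribˡ-sum (A zero j) (λ k → sgn k * (A (suc zero) (punchIn j k) * N (punchIn j ∘ punchIn k))))) ⟩
    sum (λ j → sgn j * sum (λ k → A zero j * (sgn k * (A (suc zero) (punchIn j k) * N (punchIn j ∘ punchIn k)))))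
      ≈⟨ ∑-cong (ℕ.suc (ℕ.suc n)) (λ j → *-congˡ {sgn j} (∑-cong (ℕ.suc n) (λ k →
           trans (x*yz≈y*xz (A zero j) (sgn k) _) (*-congˡ {sgn k} (*-congˡ (*-congʳ {N (punchIn j ∘ punchIn k)} (sym (A₀≈A₁ (punchIn j k))))))))) ⟩
    sum (λ j → sgn j * sum (λ k → sgn k * exchangeTerm (A zero) N j k))
      ≈⟨ signed-sum-zero (exchangeTerm (A zero) N) (exchangeTerm-symmetric (A zero) N
           (λ ρ σ ρ≡σ → det-cong (λ i k → reflexive (≡.cong (A (suc (suc i))) (ρ≡σ k))))) ⟩
    0# ∎
    where
    N : (Fin n → Fin (suc (suc n))) → Carrier
    N ρ = det (λ i → A (suc (suc i)) ∘ ρ)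

  minors-vanish : (A : Matrix (suc n)) → (∀ l → det (minor A l) ≈ 0#) → det A ≈ 0#
  minors-vanish A minor≈0 = sum-zero (laplaceTerm A) λ l →
    trans (*-congˡ (trans (*-congˡ (minor≈0 l)) (zeroʳ _))) (zeroʳ _)

  Alternation : ℕ → Set (a ⊔ ℓ)
  Alternation n = (A : Matrix n) {i j : Fin n} → i ≢ j → (∀ k → A i k ≈ A j k) → det A ≈ 0#

  -- The row equal to the first is exchanged with the second row, which reduces to
  -- `det-alternating₀₁`. Both exchanged rows lie below the first, so the sign rule for this
  -- exchange follows from alternation of the minors.
  det-alternating₀ : Alternation n → (A : Matrix (suc n)) (j : Fin n) → (∀ k → A zero k ≈ A (suc j) k) → det A ≈ 0#
  det-alternating₀ {ℕ.suc n} alternation A zero    A₀≈A₁ = det-alternating₀₁ A A₀≈A₁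
  det-alternating₀ {ℕ.suc n} alternation A (suc j) A₀≈Aⱼ = begin
    det A
      ≈⟨ det-cong (λ i k → trans (≔-self (B (A (suc zero))) j′ (λ l → sym (≔-minimal A {j′} {suc zero} (A (suc zero)) (λ ()) l)) i k)
                                 (≔-self A (suc zero) (λ _ → refl) i k)) ⟨
    det (B (A (suc zero)) [ j′ ≔ A j′ ])
      ≈⟨ antisymmetric A {suc zero} {j′} (λ ()) equal (A (suc zero)) (A j′) ⟩
    - det (B (A j′) [ j′ ≔ A (suc zero) ])
      ≈⟨ -‿cong (det-alternating₀₁ (B (A j′) [ j′ ≔ A (suc zero) ]) A₀≈Aⱼ) ⟩
    - 0#
      ≈⟨ -0#≈0# ⟩
    0# ∎
    where
    open Multilinear (det-multilinear {ℕ.suc (ℕ.suc n)})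
    j′ : Fin (ℕ.suc (ℕ.suc n))
    j′ = suc (suc j)
    B : Vector Carrier (ℕ.suc (ℕ.suc n)) → Matrix (ℕ.suc (ℕ.suc n))
    B x = A [ suc zero ≔ x ]
    equal : ∀ x → det (B x [ j′ ≔ x ]) ≈ 0#
    equal x = minors-vanish (B x [ j′ ≔ x ]) λ l →
      alternation (minor (B x [ j′ ≔ x ]) l) {zero} {suc j} (λ ())
        (λ k → sym (≔-updates (tail (B x)) (suc j) x (punchIn l k)))

  det-alternating : ∀ {n} → Alternation n
  det-alternating {ℕ.suc n} A {zero}  {zero}  i≢j Ai≈Aj = contradiction ≡.refl i≢j
  det-alternating {ℕ.suc n} A {zero}  {suc j} i≢j Ai≈Aj = det-alternating₀ det-alternating A j Ai≈Aj
  det-alternating {ℕ.suc n} A {suc i} {zero}  i≢j Ai≈Aj = det-alternating₀ det-alternating A i (sym ∘ Ai≈Aj)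
  det-alternating {ℕ.suc n} A {suc i} {suc j} i≢j Ai≈Aj = minors-vanish A λ l →
    det-alternating (minor A l) (i≢j ∘ ≡.cong suc) (λ k → Ai≈Aj (punchIn l k))

  det-isAlternating : Alternating (det {n})
  det-isAlternating = record { multilinear = det-multilinear ; alternating = det-alternating }

  det-I : ∀ n → det (I {n}) ≈ 1#
  det-I ℕ.zero    = refl
  det-I (ℕ.suc n) = begin
    det (I {ℕ.suc n})                            ≈⟨ sum-single (laplaceTerm (I {ℕ.suc n})) zero vanish ⟩
    1# * (1# * det (minor (I {ℕ.suc n}) zero))   ≈⟨ trans (*-identityˡ _) (*-identityˡ _) ⟩
    det (minor (I {ℕ.suc n}) zero)               ≈⟨ det-cong {n} (λ i k → sym (I-injective suc suc-injective i k)) ⟩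
    det (I {n})                                  ≈⟨ det-I n ⟩
    1#                                           ∎
    where
    vanish : ∀ j → j ≢ zero → laplaceTerm (I {ℕ.suc n}) j ≈ 0#
    vanish zero    0≢0 = contradiction ≡.refl 0≢0
    vanish (suc j) _   = trans (*-congˡ {sgn (suc j)} (zeroˡ _)) (zeroʳ _)

  -- For fixed `B` the left-hand side is an alternating form of the rows of `A`, so it is determined
  -- by its value at `I`.
  det-* : (A B : Matrix n) → det (A *ᴹ B) ≈ det A * det B
  det-* {n} A B = trans (alternating-unique (alternating-∘ det-isAlternating *B-linear) A)
    (*-congˡ (det-cong (λ i j → sum-I-* (λ k → B k j) i)))
    where
    *B-linear : LinearMap (λ v k → sum (λ l → v l * B l k))
    *B-linear = record
      { map-cong = λ x≈y k → ∑-cong n (λ l → *-congʳ (x≈y l))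
      ; map-linear = λ s x y k → trans (∑-cong n (λ l → trans (distribʳ _ _ _) (+-congʳ (*-assoc _ _ _))))
          (trans (∑-distrib-+ {n} _ _) (+-congʳ (sym (*-distribˡ-sum {n} s _))))
      }

  det-I≔ : (i : Fin n) (y : Vector Carrier n) → det (I [ i ≔ y ]) ≈ y i
  det-I≔ {n} i y = begin
    det (I [ i ≔ y ])                                      ≈⟨ det-cong (≔-cong I i (sum-*-I y)) ⟨
    det (I [ i ≔ (λ k → sum (λ l → y l * I l k)) ])        ≈⟨ Multilinear.linear-sum det-multilinear I i y I ⟩
    sum (λ l → y l * det (I [ i ≔ I l ]))                  ≈⟨ sum-single {n} _ i (λ l l≢i → trans (*-congˡ (repeated l l≢i)) (zeroʳ _)) ⟩
    y i * det (I [ i ≔ I i ])                              ≈⟨ *-congˡ (trans (det-cong (≔-self I i (λ _ → refl))) (det-I n)) ⟩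
    y i * 1#                                               ≈⟨ *-identityʳ _ ⟩
    y i                                                    ∎
    where
    repeated : ∀ l → l ≢ i → det (I [ i ≔ I l ]) ≈ 0#
    repeated l l≢i = det-alternating _ {i} {l} (l≢i ∘ ≡.sym)
      (λ k → trans (≔-updates I i (I l) k) (sym (≔-minimal I (I l) l≢i k)))

  det-I+rank-one : (x y : Vector Carrier n) → det (λ i k → I i k + x i * y k) ≈ 1# + sum (λ i → x i * y i)
  det-I+rank-one {n} x y = trans (rank-one det-isAlternating I x y)
    (+-cong (det-I n) (∑-cong n (λ i → *-congˡ (det-I≔ i y))))

  cornerMinor : Matrix (suc (suc n)) → Fin (suc n) → Fin (suc n) → Matrix n
  cornerMinor A i j k l = A (suc (punchIn i k)) (suc (punchIn j l))

  cornerTerm : Matrix (suc (suc n)) → Fin (suc n) → Fin (suc n) → Carrier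
  cornerTerm A i j = - (sgn j * sgn i) * (A zero (suc j) * A (suc i) zero * det (transpose (cornerMinor A i j)))

  -- The expansion along first row and first column at once. A minor that omits a later column still
  -- begins with the first column of `A`; transposing it, which is the induction hypothesis passed
  -- as an argument, makes that column a first row to expand along. The resulting double sum is
  -- visibly symmetric under transposition.
  corner-expansion : (∀ (B : Matrix (suc n)) → det B ≈ det (transpose B)) → (A : Matrix (suc (suc n))) →
    det A ≈ A zero zero * det (minor A zero) + sum (λ j → sum (λ i → cornerTerm A i j))
  corner-expansion {n} det-transpose A = +-cong (*-identityˡ _) (∑-cong (ℕ.suc n) column)
    where
    shuffle : ∀ s t x y z → - s * x * (t * (y * z)) ≈ - (s * t) * (x * y * z)
    shuffle s t x y z = begin
      - s * x * (t * (y * z))      ≈⟨ *-assoc _ _ _ ⟩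
      - s * (x * (t * (y * z)))    ≈⟨ *-congˡ (x*yz≈y*xz _ _ _) ⟩
      - s * (t * (x * (y * z)))    ≈⟨ *-assoc _ _ _ ⟨
      - s * t * (x * (y * z))      ≈⟨ *-cong (sym (-‿distribˡ-* s t)) (sym (*-assoc x y z)) ⟩
      - (s * t) * (x * y * z)      ∎
    column : ∀ j → laplaceTerm A (suc j) ≈ sum (λ i → cornerTerm A i j)
    column j = begin
      sgn (suc j) * (A zero (suc j) * det (minor A (suc j)))
        ≈⟨ *-cong (sgn-suc j) (*-congˡ (det-transpose (minor A (suc j)))) ⟩
      - sgn j * (A zero (suc j) * det (transpose (minor A (suc j))))
        ≈⟨ *-assoc _ _ _ ⟨
      - sgn j * A zero (suc j) * det (transpose (minor A (suc j)))
        ≈⟨ *-distribˡ-sum (- sgn j * A zero (suc j)) (laplaceTerm (transpose (minor A (suc j)))) ⟩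
      sum (λ i → - sgn j * A zero (suc j) * laplaceTerm (transpose (minor A (suc j))) i)
        ≈⟨ ∑-cong (ℕ.suc n) (λ i → shuffle (sgn j) (sgn i) (A zero (suc j)) (A (suc i) zero) (det (transpose (cornerMinor A i j)))) ⟩
      sum (λ i → cornerTerm A i j) ∎

  det-transpose : (A : Matrix n) → det A ≈ det (transpose A)
  det-transpose {ℕ.zero}  A = refl
  det-transpose {ℕ.suc ℕ.zero} A = refl
  det-transpose {ℕ.suc (ℕ.suc n)} A = begin
    det A
      ≈⟨ corner-expansion det-transpose A ⟩
    A zero zero * det (minor A zero) + sum (λ j → sum (λ i → cornerTerm A i j))
      ≈⟨ +-cong (*-congˡ (det-transpose (minor A zero))) (∑-cong (ℕ.suc n) (λ j → ∑-cong (ℕ.suc n) (λ i → flipTerm i j))) ⟩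
    A zero zero * det (minor (transpose A) zero) + sum (λ j → sum (λ i → cornerTerm (transpose A) j i))
      ≈⟨ +-congˡ (∑-comm (λ j i → cornerTerm (transpose A) j i)) ⟩
    A zero zero * det (minor (transpose A) zero) + sum (λ i → sum (λ j → cornerTerm (transpose A) j i))
      ≈⟨ corner-expansion det-transpose (transpose A) ⟨
    det (transpose A) ∎
    where
    flipTerm : ∀ i j → cornerTerm A i j ≈ cornerTerm (transpose A) j i
    flipTerm i j = *-cong (-‿cong (*-comm _ _)) (*-cong (*-comm _ _) (sym (det-transpose (cornerMinor A i j))))

  det-ε̃ : (A : Matrix n) → det (ε̃ A) ≈ det A
  det-ε̃ {n} A = begin
    det (w *ᴹ transpose A *ᴹ w)        ≈⟨ trans (det-* (w *ᴹ transpose A) w) (*-congʳ (det-* w (transpose A))) ⟩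
    det (w {n}) * det (transpose A) * det (w {n})  ≈⟨ *-congʳ (*-comm _ _) ⟩
    det (transpose A) * det (w {n}) * det (w {n})  ≈⟨ *-assoc _ _ _ ⟩
    det (transpose A) * (det (w {n}) * det (w {n}))  ≈⟨ *-cong (sym (det-transpose A)) (trans (sym (det-* (w {n}) w)) (trans (det-cong {n} w*w≈I) (det-I n))) ⟩
    det A * 1#                         ≈⟨ *-identityʳ _ ⟩
    det A                              ∎

-- Linear systems over a field with decidable zero and characteristic different from 2.

record IsDiscreteField (R : CommutativeRing a ℓ) : Set (a ⊔ ℓ) where
  open CommutativeRing R
  field
    zero?   : ∀ x → Dec (x ≈ 0#)
    inverse : ∀ {x} → ¬ x ≈ 0# → Σ[ y ∈ Carrier ] y * x ≈ 1#
    -- Used twice: to find anisotropic vectors, and to tell the determinants 1 and -1 apart.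
    2≉0     : ¬ 1# + 1# ≈ 0#

module DiscreteField (R : CommutativeRing a ℓ) (isDiscreteField : IsDiscreteField R) where
  open CommutativeRing R hiding (zero)
  open IsDiscreteField isDiscreteField
  open RingProperties ring
  open CommutativeSemigroupProperties *-commutativeSemigroup using () renaming (x∙yz≈y∙xz to x*yz≈y*xz)
  open SemiringSum semiring
  open SetoidReasoning setoid
  open Matrices R
  open MatrixRing R
  open Determinant R

  private
    variable
      m n : ℕ
    module L = RingLemmas ring

  1≉0 : ¬ 1# ≈ 0#
  1≉0 1≈0 = 2≉0 (trans (+-cong 1≈0 1≈0) (+-identityˡ 0#))

  *-cancel-≉0 : ∀ {x y} → ¬ x ≈ 0# → x * y ≈ 0# → y ≈ 0#
  *-cancel-≉0 {x} {y} x≉0 xy≈0 with inverse x≉0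
  ... | x⁻¹ , x⁻¹x≈1 = begin
    y                ≈⟨ *-identityˡ y ⟨
    1# * y           ≈⟨ *-congʳ x⁻¹x≈1 ⟨
    x⁻¹ * x * y      ≈⟨ *-assoc x⁻¹ x y ⟩
    x⁻¹ * (x * y)    ≈⟨ trans (*-congˡ xy≈0) (zeroʳ x⁻¹) ⟩
    0#               ∎

  x+x≈0⇒x≈0 : ∀ {x} → x + x ≈ 0# → x ≈ 0#
  x+x≈0⇒x≈0 {x} x+x≈0 = *-cancel-≉0 2≉0 (trans (distribʳ x 1# 1#) (trans (+-cong (*-identityˡ x) (*-identityˡ x)) x+x≈0))

  dot : Vector Carrier n → Vector Carrier n → Carrier
  dot x y = sum (λ i → x i * y i)

  dot-comm : (x y : Vector Carrier n) → dot x y ≈ dot y x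
  dot-comm {n} x y = ∑-cong n (λ i → *-comm (x i) (y i))

  dot-linearʳ : (x y z : Vector Carrier n) (s : Carrier) → dot x (λ i → y i + s * z i) ≈ dot x y + s * dot x z
  dot-linearʳ {n} x y z s = trans (∑-cong n (λ i → trans (distribˡ _ _ _) (+-congˡ (x*yz≈y*xz _ _ _))))
    (trans (∑-distrib-+ {n} _ _) (+-congˡ (sym (*-distribˡ-sum {n} s _))))

  dot-linearˡ : (x y z : Vector Carrier n) (s : Carrier) → dot (λ i → y i + s * z i) x ≈ dot y x + s * dot z x
  dot-linearˡ x y z s = trans (dot-comm _ x) (trans (dot-linearʳ x y z s) (+-cong (dot-comm x y) (*-congˡ (dot-comm x z))))

  _·_ : Rows m n → Vector Carrier n → Vector Carrier m
  (A · x) i = dot (A i) x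

  -- Solvability without ranks: a failure comes with a row that witnesses it, which an algebraic
  -- argument can then refute. The induction removes the first column. An obstruction `y` for the
  -- remaining columns either annihilates that column too, or serves as a pivot that fixes the first
  -- unknown.
  fredholm : (A : Rows m n) (b : Vector Carrier m) →
    (Σ[ x ∈ Vector Carrier n ] (∀ i → (A · x) i ≈ b i)) ⊎
    (Σ[ y ∈ Vector Carrier m ] (∀ k → dot y (λ i → A i k) ≈ 0#) × ¬ dot y b ≈ 0#)
  fredholm {m} {ℕ.zero} A b with all? (λ i → zero? (b i))
  ... | yes b≈0 = inj₁ ((λ ()) , λ i → sym (b≈0 i))
  ... | no ¬b≈0 with ¬∀⟶∃¬ m _ (λ i → zero? (b i)) ¬b≈0
  ...   | i , bᵢ≉0 = inj₂ (I i , (λ ()) , λ e → bᵢ≉0 (trans (sym (sum-I-* b i)) e))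
  fredholm {m} {ℕ.suc n} A b = helper (fredholm A′ b)
    where
    A′ : Rows m n
    A′ i k = A i (suc k)
    a₀ : Vector Carrier m
    a₀ i = A i zero
    Solution : Set _
    Solution =
      (Σ[ x ∈ Vector Carrier (ℕ.suc n) ] (∀ i → (A · x) i ≈ b i)) ⊎
      (Σ[ y ∈ Vector Carrier m ] (∀ k → dot y (λ i → A i k) ≈ 0#) × ¬ dot y b ≈ 0#)
    helper : (Σ[ x ∈ Vector Carrier n ] (∀ i → (A′ · x) i ≈ b i)) ⊎
             (Σ[ y ∈ Vector Carrier m ] (∀ k → dot y (λ i → A′ i k) ≈ 0#) × ¬ dot y b ≈ 0#) → Solution
    helper (inj₁ (x , A′x≈b)) = inj₁ (0# ◂ x , λ i → trans (L.+-dropˡ (zeroʳ (a₀ i))) (A′x≈b i))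
    helper (inj₂ (y , yA′≈0 , yb≉0)) with zero? (dot y a₀)
    ... | yes ya₀≈0 = inj₂ (y , (λ { zero → ya₀≈0 ; (suc k) → yA′≈0 k }) , yb≉0)
    ... | no ya₀≉0 with inverse ya₀≉0
    ...   | c , c*ya₀≈1 = pivot (fredholm A′ b′)
      where
      -- The first coordinate is forced: `y` annihilates the other columns, so pairing the system
      -- with `y` leaves `dot y a₀` times this coordinate equal to `dot y b`.
      t : Carrier
      t = dot y b * c
      b′ : Vector Carrier m
      b′ i = b i + - t * a₀ i
      -- The multiple of `y` that makes an obstruction `z` of the reduced system orthogonal to the
      -- first column; the corrected row pairs with `b` as `z` does with `b′`.
      r : Vector Carrier m → Carrier
      r z = - (dot z a₀ * c)
      clear : ∀ z → - (z * c) * dot y a₀ ≈ - z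
      clear z = trans (sym (-‿distribˡ-* _ _)) (-‿cong (trans (*-assoc _ _ _) (trans (*-congˡ c*ya₀≈1) (*-identityʳ z))))
      pivot : (Σ[ x ∈ Vector Carrier n ] (∀ i → (A′ · x) i ≈ b′ i)) ⊎
              (Σ[ z ∈ Vector Carrier m ] (∀ k → dot z (λ i → A′ i k) ≈ 0#) × ¬ dot z b′ ≈ 0#) → Solution
      pivot (inj₁ (x , A′x≈b′)) = inj₁ (t ◂ x , λ i → begin
        a₀ i * t + dot (A′ i) x            ≈⟨ +-cong (*-comm _ _) (A′x≈b′ i) ⟩
        t * a₀ i + (b i + - t * a₀ i)      ≈⟨ +-congˡ (trans (+-comm _ _) (+-congʳ (sym (-‿distribˡ-* _ _)))) ⟩
        t * a₀ i + (- (t * a₀ i) + b i)    ≈⟨ +-assoc _ _ _ ⟨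
        (t * a₀ i - t * a₀ i) + b i        ≈⟨ L.+-dropˡ (-‿inverseʳ _) ⟩
        b i                                ∎)
      pivot (inj₂ (z , zA′≈0 , zb′≉0)) = inj₂ ((λ i → z i + r z * y i) , orthogonal , λ e → zb′≉0 (trans zb′≈ e))
        where
        orthogonal : ∀ k → dot (λ i → z i + r z * y i) (λ i → A i k) ≈ 0#
        orthogonal zero    = trans (dot-linearˡ a₀ z y (r z)) (trans (+-congˡ (clear _)) (-‿inverseʳ _))
        orthogonal (suc k) = trans (dot-linearˡ (λ i → A′ i k) z y (r z))
          (trans (+-cong (zA′≈0 k) (trans (*-congˡ (yA′≈0 k)) (zeroʳ _))) (+-identityʳ 0#))
        zb′≈ : dot z b′ ≈ dot (λ i → z i + r z * y i) b
        zb′≈ = begin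
          dot z b′                                        ≈⟨ dot-linearʳ z b a₀ (- t) ⟩
          dot z b + - (dot y b * c) * dot z a₀            ≈⟨ +-congˡ (-‿distribˡ-* _ _) ⟨
          dot z b - dot y b * c * dot z a₀                ≈⟨ +-congˡ (-‿cong (trans (*-comm _ _) (trans (*-congˡ (*-comm _ _)) (sym (*-assoc _ _ _))))) ⟩
          dot z b - dot z a₀ * c * dot y b                ≈⟨ +-congˡ (-‿distribˡ-* _ _) ⟩
          dot z b + r z * dot y b                         ≈⟨ dot-linearˡ b z y (r z) ⟨
          dot (λ i → z i + r z * y i) b                   ∎

  -- The symmetric form of `w`, rank-one operators and reflections.

  form : Vector Carrier n → Vector Carrier n → Carrier
  form x y = dot (x ∘ opposite) y

  form-sym : (x y : Vector Carrier n) → form x y ≈ form y x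
  form-sym {n} x y = begin
    sum (λ k → x (opposite k) * y k)                          ≈⟨ ∑-permute {n} {n} _ Perm.reverse ⟩
    sum (λ k → x (opposite (opposite k)) * y (opposite k))    ≈⟨ ∑-cong n (λ k → trans (*-comm _ _) (*-congˡ (reflexive (≡.cong x (opposite-involutive k))))) ⟩
    sum (λ k → y (opposite k) * x k)                          ∎

  dot-cong : {x x′ y y′ : Vector Carrier n} → (∀ k → x k ≈ x′ k) → (∀ k → y k ≈ y′ k) → dot x y ≈ dot x′ y′
  dot-cong {n} x≈x′ y≈y′ = ∑-cong n (λ k → *-cong (x≈x′ k) (y≈y′ k))

  form-cong : {x x′ y y′ : Vector Carrier n} → (∀ k → x k ≈ x′ k) → (∀ k → y k ≈ y′ k) → form x y ≈ form x′ y′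
  form-cong x≈x′ = dot-cong (x≈x′ ∘ opposite)

  -- Links the involution of the matrix ring with geometry: a matrix fixed by `ε̃` is self-adjoint
  -- for the form.
  form-adjoint : (A : Matrix n) (x y : Vector Carrier n) → form (A · x) y ≈ form x (ε̃ A · y)
  form-adjoint {n} A x y = begin
    form (A · x) y                                                        ≈⟨ form-sym (A · x) y ⟩
    sum (λ k → y (opposite k) * dot (A k) x)                              ≈⟨ sum-assoc (y ∘ opposite) A x ⟨
    sum (λ l → sum (λ k → y (opposite k) * A k l) * x l)                  ≈⟨ ∑-cong n (λ l → *-comm _ _) ⟩
    dot x (λ l → sum (λ k → y (opposite k) * A k l))                      ≈⟨ ∑-permute {n} {n} _ Perm.reverse ⟩
    sum (λ l → x (opposite l) * sum (λ k → y (opposite k) * A k (opposite l)))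
      ≈⟨ ∑-cong n (λ l → *-congˡ (trans (∑-permute {n} {n} _ Perm.reverse) (∑-cong n (λ k →
           trans (*-comm _ _) (*-cong (sym (ε̃-entry A l k)) (reflexive (≡.cong y (opposite-involutive k)))))))) ⟩
    form x (ε̃ A · y)                                                      ∎

  infix 9 _⊗_
  -- The operator that sends z to `form y z` times x. Reversing the second vector builds `w` into
  -- it, so that `ε̃` just swaps the two vectors.
  _⊗_ : Vector Carrier n → Vector Carrier n → Matrix n
  (x ⊗ y) i j = x i * y (opposite j)

  ε̃-⊗ : (x y : Vector Carrier n) → ε̃ (x ⊗ y) ≈ᴹ y ⊗ x
  ε̃-⊗ x y i j = trans (ε̃-entry (x ⊗ y) i j) (trans (*-comm _ _) (*-congʳ (reflexive (≡.cong y (opposite-involutive i)))))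

  *-⊗ : (A : Matrix n) (x y : Vector Carrier n) → A *ᴹ (x ⊗ y) ≈ᴹ (A · x) ⊗ y
  *-⊗ {n} A x y i j = trans (∑-cong n (λ k → sym (*-assoc _ _ _))) (sym (*-distribʳ-sum {n} _ _))

  ⊗-· : (x y z : Vector Carrier n) → ∀ i → ((x ⊗ y) · z) i ≈ x i * form y z
  ⊗-· {n} x y z i = trans (∑-cong n (λ k → *-assoc _ _ _)) (sym (*-distribˡ-sum {n} (x i) _))

  ⊗-*-1 : (x y z u : Vector Carrier n) → form y z ≈ 1# → x ⊗ y *ᴹ z ⊗ u ≈ᴹ x ⊗ u
  ⊗-*-1 x y z u e i j = trans (*-⊗ (x ⊗ y) z u i j) (*-congʳ (trans (⊗-· x y z i) (trans (*-congˡ e) (*-identityʳ _))))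

  ⊗-*-0 : (x y z u : Vector Carrier n) → form y z ≈ 0# → x ⊗ y *ᴹ z ⊗ u ≈ᴹ (λ _ _ → 0#)
  ⊗-*-0 x y z u e i j = trans (*-⊗ (x ⊗ y) z u i j) (trans (*-congʳ (trans (⊗-· x y z i) (trans (*-congˡ e) (zeroʳ _)))) (zeroˡ _))

  infix 10 _•_
  _•_ : Carrier → Vector Carrier n → Vector Carrier n
  (c • x) i = c * x i

  form-•ˡ : ∀ c (x y : Vector Carrier n) → form (c • x) y ≈ c * form x y
  form-•ˡ {n} c x y = trans (∑-cong n (λ k → *-assoc _ _ _)) (sym (*-distribˡ-sum {n} c _))

  form-•ʳ : ∀ c (x y : Vector Carrier n) → form x (c • y) ≈ c * form x y
  form-•ʳ c x y = trans (form-sym x (c • y)) (trans (form-•ˡ c y x) (*-congˡ (form-sym y x)))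

  -- The orthogonal projection onto the line of u when ν is inverse to form u u.
  proj : Carrier → Vector Carrier n → Matrix n
  proj ν u = u ⊗ (ν • u)

  proj′ : ∀ ν (u : Vector Carrier n) → proj ν u ≈ᴹ (ν • u) ⊗ u
  proj′ ν u i j = trans (sym (*-assoc _ _ _)) (*-congʳ (*-comm _ _))

  proj-· : ∀ ν (u x : Vector Carrier n) → ∀ i → (proj ν u · x) i ≈ u i * (ν * form u x)
  proj-· ν u x i = trans (⊗-· u (ν • u) x i) (*-congˡ (form-•ˡ ν u x))

  -- A rank-one perturbation of the identity whose perturbing term has trace -2, so the determinant
  -- is 1 - 2.
  det-reflection : ∀ ν (u : Vector Carrier n) → ν * form u u ≈ 1# → det (I -ᴹ (proj ν u +ᴹ proj ν u)) ≈ - 1#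
  det-reflection {n} ν u νuu≈1 = begin
    det (I -ᴹ (proj ν u +ᴹ proj ν u))
      ≈⟨ det-cong {n} (λ i j → +-congˡ (trans (-‿cong (sym (distribʳ _ _ _))) (-‿distribˡ-* _ _))) ⟩
    det (λ i j → I i j + - (u i + u i) * (ν • u) (opposite j))
      ≈⟨ det-I+rank-one (λ i → - (u i + u i)) ((ν • u) ∘ opposite) ⟩
    1# + sum (λ i → - (u i + u i) * (ν • u) (opposite i))
      ≈⟨ +-congˡ (∑-cong n (λ i → trans (sym (-‿distribˡ-* _ _)) (-‿cong (trans (distribʳ _ _ _) (+-cong (*-comm _ _) (*-comm _ _)))))) ⟩
    1# + sum (λ i → - ((ν • u) (opposite i) * u i + (ν • u) (opposite i) * u i))
      ≈⟨ +-congˡ (trans (sum-neg {n} _) (-‿cong (∑-distrib-+ {n} _ _))) ⟩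
    1# - (form (ν • u) u + form (ν • u) u)
      ≈⟨ +-congˡ (-‿cong (+-cong ⟨u,u⟩≈1 ⟨u,u⟩≈1)) ⟩
    1# - (1# + 1#)
      ≈⟨ +-congˡ (-‿+-comm 1# 1#) ⟨
    1# + (- 1# - 1#)
      ≈⟨ +-assoc _ _ _ ⟨
    (1# - 1#) - 1#
      ≈⟨ L.+-dropˡ (-‿inverseʳ 1#) ⟩
    - 1# ∎
    where
    ⟨u,u⟩≈1 : form (ν • u) u ≈ 1#
    ⟨u,u⟩≈1 = trans (form-•ˡ ν u u) νuu≈1

  form-0 : ∀ (y : Vector Carrier n) {z} → (∀ k → z k ≈ 0#) → form y z ≈ 0#
  form-0 y z≈0 = sum-zero _ (λ k → trans (*-congˡ (z≈0 k)) (zeroʳ _))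

  form-I : (i : Fin n) (y : Vector Carrier n) → form (I (opposite i)) y ≈ y i
  form-I {n} i y = trans (dot-cong {y = y} (λ k → sym (I-injective opposite opposite-injective i k)) (λ _ → refl)) (sum-I-* y i)
    where
    opposite-injective : {i j : Fin n} → opposite i ≡ opposite j → i ≡ j
    opposite-injective e = ≡.trans (≡.sym (opposite-involutive _)) (≡.trans (≡.cong opposite e) (opposite-involutive _))

  ·-I : (A : Matrix n) (j : Fin n) → ∀ i → (A · I j) i ≈ A i j
  ·-I {n} A j i = trans (∑-cong n (λ k → *-congˡ (I-sym j k))) (sum-*-I (A i) j)

  ·-· : (A B : Matrix n) (x : Vector Carrier n) → ∀ i → ((A *ᴹ B) · x) i ≈ (A · (B · x)) i
  ·-· A B x i = sum-assoc (A i) B x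

  -- Orthogonal lines in the image of a self-adjoint idempotent, and its skew units.

  module _ {n : ℕ} where
    private
      module M = Ring (matrixRing n)
      module MR = SetoidReasoning M.setoid
      module MP = RingProperties (matrixRing n)
      module ML = RingLemmas (matrixRing n)
    open StarRing (matrixRing n) ε̃ ε̃-isInvolution

    reflection : Matrix n → Matrix n
    reflection Q = I -ᴹ (Q +ᴹ Q)

    -- For a self-adjoint idempotent this is an orthogonal basis of its image, peeled off one
    -- anisotropic line at a time. The number of steps stands in for the rank, and its parity is
    -- read off by recursion.
    data Splitting : Matrix n → Set (a ⊔ ℓ) where
      done : ∀ {Q} → Q ≈ᴹ M.0# → Splitting Q
      step : ∀ {Q} ν (u : Vector Carrier n) → ν * form u u ≈ 1# → (∀ i → (Q · u) i ≈ u i) →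
             Splitting (Q -ᴹ proj ν u) → Splitting Q

    proj-⋆ : ∀ ν (u : Vector Carrier n) → ε̃ (proj ν u) ≈ᴹ proj ν u
    proj-⋆ ν u i j = trans (ε̃-⊗ u (ν • u) i j) (sym (proj′ ν u i j))

    module _ {ν} {u : Vector Carrier n} (νuu≈1 : ν * form u u ≈ 1#) where

      proj-idempotent : proj ν u *ᴹ proj ν u ≈ᴹ proj ν u
      proj-idempotent = ⊗-*-1 u (ν • u) u (ν • u) (trans (form-•ˡ ν u u) νuu≈1)

      absorb-proj : ∀ {Q} → (∀ i → (Q · u) i ≈ u i) → Q *ᴹ proj ν u ≈ᴹ proj ν u
      absorb-proj {Q} Qu≈u i j = trans (*-⊗ Q u (ν • u) i j) (*-congʳ (Qu≈u i))

    -- One Gram-Schmidt step. Because `Q` is a self-adjoint idempotent, `form u u` equals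
    -- `form x (Q · x)`, so the line of `u` is anisotropic and lies in the image.
    module Pivot {Q : Matrix n} (Q⋆≈Q : ε̃ Q ≈ᴹ Q) (QQ≈Q : Q *ᴹ Q ≈ᴹ Q)
                 (x : Vector Carrier n) (φ≉0 : ¬ form x (Q · x) ≈ 0#) where

      u : Vector Carrier n
      u = Q · x

      ν : Carrier
      ν = proj₁ (inverse φ≉0)

      νφ≈1 : ν * form x (Q · x) ≈ 1#
      νφ≈1 = proj₂ (inverse φ≉0)

      Qu≈u : ∀ i → (Q · u) i ≈ u i
      Qu≈u i = trans (sym (·-· Q Q x i)) (dot-cong {y = x} (QQ≈Q i) (λ _ → refl))

      form-u : ∀ y → form u y ≈ form x (Q · y)
      form-u y = trans (form-adjoint Q x y)
        (form-cong {x = x} (λ _ → refl) (λ k → dot-cong {y = y} (Q⋆≈Q k) (λ _ → refl)))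

      νuu≈1 : ν * form u u ≈ 1#
      νuu≈1 = trans (*-congˡ (trans (form-u u) (form-cong {x = x} (λ _ → refl) Qu≈u))) νφ≈1

      ν≉0 : ¬ ν ≈ 0#
      ν≉0 ν≈0 = 1≉0 (trans (sym νφ≈1) (trans (*-congʳ ν≈0) (zeroˡ _)))

      Q′ : Matrix n
      Q′ = Q -ᴹ proj ν u

      module C = Complement {Q} {proj ν u} Q⋆≈Q QQ≈Q (proj-⋆ ν u) (proj-idempotent νuu≈1) (absorb-proj νuu≈1 {Q} Qu≈u)

      Q′-· : ∀ y i → (Q′ · y) i ≈ (Q · y) i + - (ν * form x (Q · y)) * u i
      Q′-· y i = begin
        dot (λ k → Q i k + - proj ν u i k) y         ≈⟨ dot-cong {y = y} (λ k → +-congˡ {Q i k} (trans (-‿cong (sym (*-identityˡ _))) (-‿distribˡ-* 1# _))) (λ _ → refl) ⟩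
        dot (λ k → Q i k + - 1# * proj ν u i k) y    ≈⟨ dot-linearˡ y (Q i) (proj ν u i) (- 1#) ⟩
        (Q · y) i + - 1# * (proj ν u · y) i          ≈⟨ +-congˡ (trans (sym (-‿distribˡ-* 1# _)) (-‿cong (*-identityˡ _))) ⟩
        (Q · y) i - (proj ν u · y) i                 ≈⟨ +-congˡ (-‿cong (trans (proj-· ν u y i) (trans (*-comm _ _) (*-congʳ (*-congˡ (form-u y)))))) ⟩
        (Q · y) i - ν * form x (Q · y) * u i         ≈⟨ +-congˡ (-‿distribˡ-* _ _) ⟩
        (Q · y) i + - (ν * form x (Q · y)) * u i     ∎

      -- The progress made by a step: `x` joins the kernel, and by `kernel-preserved` nothing leaves
      -- it.
      kills-pivot : ∀ i → (Q′ · x) i ≈ 0#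
      kills-pivot i = trans (Q′-· x i) (trans (+-congˡ (trans (sym (-‿distribˡ-* _ _)) (-‿cong (trans (*-congʳ νφ≈1) (*-identityˡ _))))) (-‿inverseʳ _))

      kernel-preserved : ∀ y → (∀ i → (Q · y) i ≈ 0#) → ∀ i → (Q′ · y) i ≈ 0#
      kernel-preserved y Qy≈0 i = trans (Q′-· y i) (trans (+-cong (Qy≈0 i)
        (trans (*-congʳ (trans (-‿cong (trans (*-congˡ (form-0 x Qy≈0)) (zeroʳ _))) -0#≈0#)) (zeroˡ _))) (+-identityʳ 0#))

    -- The invariant behind termination: `js` lists the basis vectors that may still lie outside the
    -- kernel of `Q`, and each round of the recursion on `js` disposes of one of them.
    Covers : List (Fin n) → Matrix n → Set ℓ
    Covers js Q = ∀ j → j ∈ js ⊎ (∀ i → (Q · I j) i ≈ 0#)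

    Splits : List (Fin n) → Set (a ⊔ ℓ)
    Splits js = ∀ Q → ε̃ Q ≈ᴹ Q → Q *ᴹ Q ≈ᴹ Q → Covers js Q → Splitting Q

    covers-tail : ∀ {j js Q} → (∀ i → (Q · I j) i ≈ 0#) → Covers (j ∷ js) Q → Covers js Q
    covers-tail Qⱼ≈0 covers k with covers k
    ... | inj₁ (here ≡.refl) = inj₂ Qⱼ≈0
    ... | inj₁ (there k∈js)  = inj₁ k∈js
    ... | inj₂ Qₖ≈0          = inj₂ Qₖ≈0

    covers-mono : ∀ {js Q Q′} → (∀ y → (∀ i → (Q · y) i ≈ 0#) → ∀ i → (Q′ · y) i ≈ 0#) → Covers js Q → Covers js Q′
    covers-mono kernel covers k with covers k
    ... | inj₁ k∈js = inj₁ k∈js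
    ... | inj₂ Qₖ≈0 = inj₂ (kernel (I k) Qₖ≈0)

    splits-anisotropic : ∀ {j js} → Splits js → ∀ Q → ε̃ Q ≈ᴹ Q → Q *ᴹ Q ≈ᴹ Q → Covers (j ∷ js) Q →
      ¬ form (I j) (Q · I j) ≈ 0# → Splitting Q
    splits-anisotropic {j} splits Q Q⋆≈Q QQ≈Q covers φ≉0 =
      step ν u νuu≈1 Qu≈u (splits Q′ C.complement-⋆ C.complement-idempotent
        (covers-tail {Q = Q′} kills-pivot (covers-mono {Q = Q} {Q′} kernel-preserved covers)))
      where open Pivot Q⋆≈Q QQ≈Q (I j) φ≉0

    -- If e_j is isotropic but pairs with x, then for τ = 1 or -1 the vector
    -- x + τ e_j is anisotropic, and e_j becomes anisotropic after splitting it off.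
    splits-isotropic : ∀ {j js} → Splits js → ∀ Q → ε̃ Q ≈ᴹ Q → Q *ᴹ Q ≈ᴹ Q → Covers (j ∷ js) Q →
      form (I j) (Q · I j) ≈ 0# → ∀ x → ¬ form x (Q · I j) ≈ 0# → Splitting Q
    splits-isotropic {j} {js} splits Q Q⋆≈Q QQ≈Q covers φ≈0 x β≉0 = choose (zero? (γ + (β + β)))
      where
      y : Vector Carrier n
      y = I j
      β γ : Carrier
      β = form x (Q · y)
      γ = form x (Q · x)
      v : Carrier → Vector Carrier n
      v τ k = x k + τ * y k
      form-v : ∀ τ z → form (v τ) z ≈ form x z + τ * form y z
      form-v τ z = dot-linearˡ z (x ∘ opposite) (y ∘ opposite) τ
      form-yQx : form y (Q · x) ≈ β
      form-yQx = trans (form-sym y (Q · x)) (trans (form-adjoint Q x y)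
        (form-cong {x = x} (λ _ → refl) (λ k → dot-cong {y = y} (Q⋆≈Q k) (λ _ → refl))))
      form-Qv : ∀ τ z → form z (Q · v τ) ≈ form z (Q · x) + τ * form z (Q · y)
      form-Qv τ z = trans (form-cong {x = z} (λ _ → refl) (λ k → dot-linearʳ (Q k) x y τ)) (dot-linearʳ (z ∘ opposite) (Q · x) (Q · y) τ)
      norm-v : ∀ τ → form (v τ) (Q · v τ) ≈ γ + (τ * β + τ * β)
      norm-v τ = begin
        form (v τ) (Q · v τ)                                ≈⟨ form-v τ _ ⟩
        form x (Q · v τ) + τ * form y (Q · v τ)             ≈⟨ +-cong (form-Qv τ x) (*-congˡ (form-Qv τ y)) ⟩
        (γ + τ * β) + τ * (form y (Q · x) + τ * form y (Q · y))    ≈⟨ +-congˡ (*-congˡ (trans (+-cong form-yQx (trans (*-congˡ φ≈0) (zeroʳ τ))) (+-identityʳ β))) ⟩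
        (γ + τ * β) + τ * β                                 ≈⟨ +-assoc _ _ _ ⟩
        γ + (τ * β + τ * β)                                 ∎
      finish : ∀ τ → ¬ γ + (τ * β + τ * β) ≈ 0# → Splitting Q
      finish τ norm≉0 = step P.ν P.u P.νuu≈1 P.Qu≈u
        (splits-anisotropic splits P.Q′ P.C.complement-⋆ P.C.complement-idempotent
          (covers-mono {Q = Q} {P.Q′} P.kernel-preserved covers) φ′≉0)
        where
        module P = Pivot Q⋆≈Q QQ≈Q (v τ) (λ e → norm≉0 (trans (sym (norm-v τ)) e))
        form-vQy : form (v τ) (Q · y) ≈ β
        form-vQy = trans (form-v τ (Q · y)) (trans (+-congˡ (trans (*-congˡ φ≈0) (zeroʳ τ))) (+-identityʳ β))
        φ′≈ : form y (P.Q′ · y) ≈ - (P.ν * (β * β))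
        φ′≈ = begin
          form y (P.Q′ · y)
            ≈⟨ form-cong {x = y} (λ _ → refl) (P.Q′-· y) ⟩
          form y (λ i → (Q · y) i + - (P.ν * form (v τ) (Q · y)) * P.u i)
            ≈⟨ dot-linearʳ (y ∘ opposite) (Q · y) P.u _ ⟩
          form y (Q · y) + - (P.ν * form (v τ) (Q · y)) * form y P.u
            ≈⟨ +-cong φ≈0 (*-cong (-‿cong (*-congˡ form-vQy)) (trans (form-sym y P.u) (trans (P.form-u y) form-vQy))) ⟩
          0# + - (P.ν * β) * β
            ≈⟨ +-identityˡ _ ⟩
          - (P.ν * β) * β
            ≈⟨ -‿distribˡ-* _ _ ⟨
          - (P.ν * β * β)
            ≈⟨ -‿cong (*-assoc _ _ _) ⟩
          - (P.ν * (β * β)) ∎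
        φ′≉0 : ¬ form y (P.Q′ · y) ≈ 0#
        φ′≉0 e = β≉0 (*-cancel-≉0 β≉0 (*-cancel-≉0 P.ν≉0
          (trans (sym (-‿involutive _)) (trans (-‿cong (trans (sym φ′≈) e)) -0#≈0#))))
      choose : Dec (γ + (β + β) ≈ 0#) → Splitting Q
      choose (no norm≉0) = finish 1# (λ e → norm≉0 (trans (+-congˡ (sym (+-cong (*-identityˡ β) (*-identityˡ β)))) e))
      -- If both candidates were isotropic, γ + 2β and γ - 2β would vanish together, hence 4β = 0.
      choose (yes γ+2β≈0) = finish (- 1#) (λ e → β≉0 (x+x≈0⇒x≈0 (x+x≈0⇒x≈0 (begin
        (β + β) + (β + β)                        ≈⟨ +-congˡ (-‿involutive _) ⟨
        (β + β) - - (β + β)                      ≈⟨ +-congˡ (-‿cong (trans (sym (-‿+-comm β β)) (sym (+-cong -1β≈ -1β≈)))) ⟩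
        (β + β) - (- 1# * β + - 1# * β)          ≈⟨ +-cong (+-inverseʳ-unique γ _ γ+2β≈0) (-‿cong (+-inverseʳ-unique γ _ e)) ⟩
        - γ - - γ                                ≈⟨ -‿inverseʳ _ ⟩
        0#                                       ∎))))
        where
        -1β≈ : - 1# * β ≈ - β
        -1β≈ = trans (sym (-‿distribˡ-* 1# β)) (-‿cong (*-identityˡ β))

    splits : ∀ js → Splits js
    splits [] Q Q⋆≈Q QQ≈Q covers = done zeroes
      where
      zeroes : Q ≈ᴹ M.0#
      zeroes i j with covers j
      ... | inj₂ Qⱼ≈0 = trans (sym (·-I Q j i)) (Qⱼ≈0 i)
    splits (j ∷ js) Q Q⋆≈Q QQ≈Q covers with zero? (form (I j) (Q · I j))
    ... | no φ≉0 = splits-anisotropic (splits js) Q Q⋆≈Q QQ≈Q covers φ≉0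
    ... | yes φ≈0 with all? (λ i → zero? ((Q · I j) i))
    ...   | yes Qⱼ≈0 = splits js Q Q⋆≈Q QQ≈Q (covers-tail {Q = Q} Qⱼ≈0 covers)
    -- Nondegeneracy of the form: coordinate `i` of a vector is its pairing with the basis vector at
    -- `opposite i`, so a nonzero coordinate supplies the partner `x`.
    ...   | no ¬Qⱼ≈0 with ¬∀⟶∃¬ n _ (λ i → zero? ((Q · I j) i)) ¬Qⱼ≈0
    ...     | i , β≉0 = splits-isotropic (splits js) Q Q⋆≈Q QQ≈Q covers φ≈0 (I (opposite i))
                          (λ e → β≉0 (trans (sym (form-I i (Q · I j))) e))

    -- The quarter turn of the plane. With s = u₁ ⊗ u₂ - u₂ ⊗ u₁, the vector u₂ goes to `form u₂ u₂`
    -- times u₁, and u₁ to minus `form u₁ u₁` times u₂. Its inverse is the opposite turn with both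
    -- vectors scaled by their `ν`.
    skewUnit-plane : ∀ {ν₁ ν₂} {u₁ u₂ : Vector Carrier n} → ν₁ * form u₁ u₁ ≈ 1# → ν₂ * form u₂ u₂ ≈ 1# →
      form u₁ u₂ ≈ 0# → SkewUnit (proj ν₂ u₂ +ᴹ proj ν₁ u₁)
    skewUnit-plane {ν₁} {ν₂} {u₁} {u₂} ν₁≈1 ν₂≈1 u₁u₂≈0 = record
      { s = s ; t = t
      ; s⋆≈-s = skew u₁ u₂
      ; t⋆≈-t = skew (ν₂ • u₂) (ν₁ • u₁)
      ; qs≈s = MR.begin
          (proj ν₂ u₂ M.+ proj ν₁ u₁) M.* (a₁₂ M.- a₂₁)    MR.≈⟨ expand (proj ν₂ u₂) (proj ν₁ u₁) a₁₂ a₂₁ ⟩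
          (proj ν₂ u₂ M.* a₁₂ M.- proj ν₂ u₂ M.* a₂₁) M.+ (proj ν₁ u₁ M.* a₁₂ M.- proj ν₁ u₁ M.* a₂₁)
            MR.≈⟨ M.+-cong (M.+-cong (⊗-*-0 u₂ (ν₂ • u₂) u₁ u₂ (kill (form-•ˡ ν₂ u₂ u₁) u₂u₁≈0))
                                      (M.-‿cong (⊗-*-1 u₂ (ν₂ • u₂) u₂ u₁ ⟨u₂′,u₂⟩)))
                           (M.+-cong (⊗-*-1 u₁ (ν₁ • u₁) u₁ u₂ ⟨u₁′,u₁⟩)
                                      (M.-‿cong (⊗-*-0 u₁ (ν₁ • u₁) u₂ u₁ (kill (form-•ˡ ν₁ u₁ u₂) u₁u₂≈0)))) ⟩
          (M.0# M.- a₂₁) M.+ (a₁₂ M.- M.0#)                 MR.≈⟨ tidy a₂₁ a₁₂ ⟩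
          a₁₂ M.- a₂₁                                       MR.∎
      ; qt≈t = MR.begin
          (proj ν₂ u₂ M.+ proj ν₁ u₁) M.* (b₂₁ M.- b₁₂)
            MR.≈⟨ M.*-congʳ {b₂₁ M.- b₁₂} (M.+-cong (proj′ ν₂ u₂) (proj′ ν₁ u₁)) ⟩
          ((ν₂ • u₂) ⊗ u₂ M.+ (ν₁ • u₁) ⊗ u₁) M.* (b₂₁ M.- b₁₂)
            MR.≈⟨ expand ((ν₂ • u₂) ⊗ u₂) ((ν₁ • u₁) ⊗ u₁) b₂₁ b₁₂ ⟩
          ((ν₂ • u₂) ⊗ u₂ M.* b₂₁ M.- (ν₂ • u₂) ⊗ u₂ M.* b₁₂) M.+ ((ν₁ • u₁) ⊗ u₁ M.* b₂₁ M.- (ν₁ • u₁) ⊗ u₁ M.* b₁₂)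
            MR.≈⟨ M.+-cong (M.+-cong (⊗-*-1 (ν₂ • u₂) u₂ (ν₂ • u₂) (ν₁ • u₁) ⟨u₂,u₂′⟩)
                                      (M.-‿cong (⊗-*-0 (ν₂ • u₂) u₂ (ν₁ • u₁) (ν₂ • u₂) (kill (form-•ʳ ν₁ u₂ u₁) u₂u₁≈0))))
                           (M.+-cong (⊗-*-0 (ν₁ • u₁) u₁ (ν₂ • u₂) (ν₁ • u₁) (kill (form-•ʳ ν₂ u₁ u₂) u₁u₂≈0))
                                      (M.-‿cong (⊗-*-1 (ν₁ • u₁) u₁ (ν₁ • u₁) (ν₂ • u₂) ⟨u₁,u₁′⟩))) ⟩
          (b₂₁ M.- M.0#) M.+ (M.0# M.- b₁₂)                 MR.≈⟨ M.+-cong (sub-0 b₂₁) (M.+-identityˡ _) ⟩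
          b₂₁ M.- b₁₂                                       MR.∎
      ; st≈q = MR.begin
          (a₁₂ M.- a₂₁) M.* (b₂₁ M.- b₁₂)                   MR.≈⟨ expand a₁₂ (M.- a₂₁) b₂₁ b₁₂ ⟩
          (a₁₂ M.* b₂₁ M.- a₁₂ M.* b₁₂) M.+ ((M.- a₂₁) M.* b₂₁ M.- (M.- a₂₁) M.* b₁₂)
            MR.≈⟨ M.+-cong (M.+-cong (⊗-*-1 u₁ u₂ (ν₂ • u₂) (ν₁ • u₁) ⟨u₂,u₂′⟩)
                                      (M.-‿cong (⊗-*-0 u₁ u₂ (ν₁ • u₁) (ν₂ • u₂) (kill (form-•ʳ ν₁ u₂ u₁) u₂u₁≈0))))
                (M.+-cong (M.trans (M.sym (MP.-‿distribˡ-* a₂₁ b₂₁)) (M.-‿cong (⊗-*-0 u₂ u₁ (ν₂ • u₂) (ν₁ • u₁) (kill (form-•ʳ ν₂ u₁ u₂) u₁u₂≈0))))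
                          (M.trans (M.-‿cong (M.sym (MP.-‿distribˡ-* a₂₁ b₁₂))) (M.trans (MP.-‿involutive _) (⊗-*-1 u₂ u₁ (ν₁ • u₁) (ν₂ • u₂) ⟨u₁,u₁′⟩)))) ⟩
          (proj ν₁ u₁ M.- M.0#) M.+ (M.- M.0# M.+ proj ν₂ u₂)
            MR.≈⟨ M.+-cong (sub-0 (proj ν₁ u₁)) (M.trans (M.+-congʳ MP.-0#≈0#) (M.+-identityˡ _)) ⟩
          proj ν₁ u₁ M.+ proj ν₂ u₂                         MR.≈⟨ M.+-comm (proj ν₁ u₁) (proj ν₂ u₂) ⟩
          proj ν₂ u₂ M.+ proj ν₁ u₁                         MR.∎
      }
      where
      a₁₂ a₂₁ b₁₂ b₂₁ s t : Matrix n
      a₁₂ = u₁ ⊗ u₂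
      a₂₁ = u₂ ⊗ u₁
      b₁₂ = (ν₁ • u₁) ⊗ (ν₂ • u₂)
      b₂₁ = (ν₂ • u₂) ⊗ (ν₁ • u₁)
      s = a₁₂ M.- a₂₁
      t = b₂₁ M.- b₁₂
      skew : (x y : Vector Carrier n) → ε̃ (x ⊗ y M.- y ⊗ x) ≈ᴹ M.- (x ⊗ y M.- y ⊗ x)
      skew x y = M.trans (IsInvolution.⋆-+ ε̃-isInvolution (x ⊗ y) (M.- y ⊗ x))
        (M.trans (M.+-cong (ε̃-⊗ x y) (M.trans (⋆-neg (y ⊗ x)) (M.-‿cong (ε̃-⊗ y x))))
          (M.sym (M.trans (M.sym (MP.-‿+-comm (x ⊗ y) (M.- (y ⊗ x)))) (M.trans (M.+-congˡ {M.- (x ⊗ y)} (MP.-‿involutive (y ⊗ x))) (M.+-comm (M.- (x ⊗ y)) (y ⊗ x))))))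
      u₂u₁≈0 : form u₂ u₁ ≈ 0#
      u₂u₁≈0 = trans (form-sym u₂ u₁) u₁u₂≈0
      kill : ∀ {x c y} → x ≈ c * y → y ≈ 0# → x ≈ 0#
      kill x≈cy y≈0 = trans x≈cy (trans (*-congˡ y≈0) (zeroʳ _))
      ⟨u₁′,u₁⟩ : form (ν₁ • u₁) u₁ ≈ 1#
      ⟨u₁′,u₁⟩ = trans (form-•ˡ ν₁ u₁ u₁) ν₁≈1
      ⟨u₂′,u₂⟩ : form (ν₂ • u₂) u₂ ≈ 1#
      ⟨u₂′,u₂⟩ = trans (form-•ˡ ν₂ u₂ u₂) ν₂≈1
      ⟨u₁,u₁′⟩ : form u₁ (ν₁ • u₁) ≈ 1#
      ⟨u₁,u₁′⟩ = trans (form-•ʳ ν₁ u₁ u₁) ν₁≈1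
      ⟨u₂,u₂′⟩ : form u₂ (ν₂ • u₂) ≈ 1#
      ⟨u₂,u₂′⟩ = trans (form-•ʳ ν₂ u₂ u₂) ν₂≈1
      expand : (A B C D : Matrix n) → (A M.+ B) M.* (C M.- D) ≈ᴹ (A M.* C M.- A M.* D) M.+ (B M.* C M.- B M.* D)
      expand A B C D = M.trans (M.distribʳ (C M.- D) A B) (M.+-cong (MP.x[y-z]≈xy-xz A C D) (MP.x[y-z]≈xy-xz B C D))
      sub-0 : (A : Matrix n) → A M.- M.0# ≈ᴹ A
      sub-0 A = ML.+-dropʳ MP.-0#≈0#
      tidy : (A B : Matrix n) → (M.0# M.- A) M.+ (B M.- M.0#) ≈ᴹ B M.- A
      tidy A B = M.trans (M.+-cong (M.+-identityˡ (M.- A)) (sub-0 B)) (M.+-comm (M.- A) B)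

    det-reflection-complement : ∀ {Q ν} {u : Vector Carrier n} → ε̃ Q ≈ᴹ Q → Q *ᴹ Q ≈ᴹ Q → ν * form u u ≈ 1# → (∀ i → (Q · u) i ≈ u i) →
      det (reflection Q) ≈ - det (reflection (Q -ᴹ proj ν u))
    det-reflection-complement {Q} {ν} {u} Q⋆≈Q QQ≈Q νuu≈1 Qu≈u = begin
      det (reflection Q)                                          ≈⟨ det-cong C.reflection-* ⟨
      det (reflection (Q -ᴹ proj ν u) *ᴹ reflection (proj ν u))   ≈⟨ det-* (reflection (Q -ᴹ proj ν u)) (reflection (proj ν u)) ⟩
      det (reflection (Q -ᴹ proj ν u)) * det (reflection (proj ν u))    ≈⟨ *-congˡ (det-reflection ν u νuu≈1) ⟩
      det (reflection (Q -ᴹ proj ν u)) * - 1#                     ≈⟨ -‿distribʳ-* _ 1# ⟨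
      - (det (reflection (Q -ᴹ proj ν u)) * 1#)                   ≈⟨ -‿cong (*-identityʳ _) ⟩
      - det (reflection (Q -ᴹ proj ν u))                          ∎
      where module C = Complement {Q} {proj ν u} Q⋆≈Q QQ≈Q (proj-⋆ ν u) (proj-idempotent νuu≈1) (absorb-proj νuu≈1 {Q} Qu≈u)

    -- Recursion by two lines at a time. A pair of lines contributes a plane with its skew unit and
    -- changes the determinant by (-1)(-1), while a single line left at the end makes the
    -- determinant -1.
    skewUnit-or-improper : ∀ {Q} → Splitting Q → ε̃ Q ≈ᴹ Q → Q *ᴹ Q ≈ᴹ Q → SkewUnit Q ⊎ det (reflection Q) ≈ - 1#
    skewUnit-or-improper (done Q≈0) Q⋆≈Q QQ≈Q = inj₁ (skewUnit-cong (M.sym Q≈0) skewUnit-0)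
    skewUnit-or-improper {Q} (step ν u νuu≈1 Qu≈u (done Q′≈0)) Q⋆≈Q QQ≈Q = inj₂ (begin
      det (reflection Q)                    ≈⟨ det-reflection-complement {Q} Q⋆≈Q QQ≈Q νuu≈1 Qu≈u ⟩
      - det (reflection (Q -ᴹ proj ν u))    ≈⟨ -‿cong (det-cong (M.+-congˡ {I} (M.trans (M.-‿cong (M.trans (M.+-cong Q′≈0 Q′≈0) (M.+-identityˡ M.0#))) MP.-0#≈0#))) ⟩
      - det (I {n} +ᴹ M.0#)                 ≈⟨ -‿cong (trans (det-cong (M.+-identityʳ I)) (det-I n)) ⟩
      - 1#                                  ∎)
    skewUnit-or-improper {Q} (step ν₁ u₁ ν₁≈1 Qu₁≈u₁ (step ν₂ u₂ ν₂≈1 Q′u₂≈u₂ splitting)) Q⋆≈Q QQ≈Q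
      with skewUnit-or-improper splitting C₂.complement-⋆ C₂.complement-idempotent
      where
      module C₁ = Complement {Q} {proj ν₁ u₁} Q⋆≈Q QQ≈Q (proj-⋆ ν₁ u₁) (proj-idempotent ν₁≈1) (absorb-proj ν₁≈1 {Q} Qu₁≈u₁)
      module C₂ = Complement {Q -ᴹ proj ν₁ u₁} {proj ν₂ u₂} C₁.complement-⋆ C₁.complement-idempotent (proj-⋆ ν₂ u₂) (proj-idempotent ν₂≈1) (absorb-proj ν₂≈1 {Q -ᴹ proj ν₁ u₁} Q′u₂≈u₂)
    ... | inj₂ improper = inj₂ (begin
      det (reflection Q)                                     ≈⟨ det-reflection-complement {Q} Q⋆≈Q QQ≈Q ν₁≈1 Qu₁≈u₁ ⟩
      - det (reflection (Q -ᴹ proj ν₁ u₁))                   ≈⟨ -‿cong (det-reflection-complement {Q -ᴹ proj ν₁ u₁} C₁.complement-⋆ C₁.complement-idempotent ν₂≈1 Q′u₂≈u₂) ⟩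
      - - det (reflection (Q -ᴹ proj ν₁ u₁ -ᴹ proj ν₂ u₂))   ≈⟨ -‿involutive _ ⟩
      det (reflection (Q -ᴹ proj ν₁ u₁ -ᴹ proj ν₂ u₂))       ≈⟨ improper ⟩
      - 1#                                                   ∎)
      where
      module C₁ = Complement {Q} {proj ν₁ u₁} Q⋆≈Q QQ≈Q (proj-⋆ ν₁ u₁) (proj-idempotent ν₁≈1) (absorb-proj ν₁≈1 {Q} Qu₁≈u₁)
    ... | inj₁ U = inj₁ (skewUnit-cong
        (M.trans (M.sym (M.+-assoc Q₂ e₂ e₁)) (M.trans (M.+-congʳ {e₁} C₂.complement-+) C₁.complement-+))
        (skewUnit-+ C₂.complement-⋆ (M.trans (IsInvolution.⋆-+ ε̃-isInvolution e₂ e₁) (M.+-cong (proj-⋆ ν₂ u₂) (proj-⋆ ν₁ u₁)))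
          (M.trans (M.distribˡ Q₂ e₂ e₁) (M.trans (M.+-cong C₂.complement-e Q₂e₁≈0) (M.+-identityˡ M.0#)))
          U (skewUnit-plane ν₁≈1 ν₂≈1 u₁u₂≈0)))
      where
      module C₁ = Complement {Q} {proj ν₁ u₁} Q⋆≈Q QQ≈Q (proj-⋆ ν₁ u₁) (proj-idempotent ν₁≈1) (absorb-proj ν₁≈1 {Q} Qu₁≈u₁)
      module C₂ = Complement {Q -ᴹ proj ν₁ u₁} {proj ν₂ u₂} C₁.complement-⋆ C₁.complement-idempotent (proj-⋆ ν₂ u₂) (proj-idempotent ν₂≈1) (absorb-proj ν₂≈1 {Q -ᴹ proj ν₁ u₁} Q′u₂≈u₂)
      e₁ e₂ Q₁ Q₂ : Matrix n
      e₁ = proj ν₁ u₁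
      e₂ = proj ν₂ u₂
      Q₁ = Q -ᴹ e₁
      Q₂ = Q₁ -ᴹ e₂
      Q₂e₁≈0 : Q₂ *ᴹ e₁ ≈ᴹ M.0#
      Q₂e₁≈0 = M.trans (MP.[y-z]x≈yx-zx e₁ Q₁ e₂) (M.trans (M.+-cong C₁.complement-e
        (M.trans (M.-‿cong (viaʳ C₂.eq≈e C₁.complement-e)) MP.-0#≈0#)) (M.+-identityʳ M.0#))
      -- `u₂` is fixed by the self-adjoint `Q₁`, which kills `u₁`.
      u₁u₂≈0 : form u₁ u₂ ≈ 0#
      u₁u₂≈0 = begin
        form u₁ u₂             ≈⟨ form-cong {x = u₁} (λ _ → refl) Q′u₂≈u₂ ⟨
        form u₁ (Q₁ · u₂)      ≈⟨ form-cong {x = u₁} (λ _ → refl) (λ k → dot-cong {y = u₂} (C₁.complement-⋆ k) (λ _ → refl)) ⟨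
        form u₁ (ε̃ Q₁ · u₂)    ≈⟨ form-adjoint Q₁ u₁ u₂ ⟨
        form (Q₁ · u₁) u₂      ≈⟨ form-cong {y = u₂} Q₁u₁≈0 (λ _ → refl) ⟩
        form (λ _ → 0#) u₂     ≈⟨ form-sym (λ _ → 0#) u₂ ⟩
        form u₂ (λ _ → 0#)     ≈⟨ form-0 u₂ (λ _ → refl) ⟩
        0#                     ∎
        where
        e₁u₁≈u₁ : ∀ i → (e₁ · u₁) i ≈ u₁ i
        e₁u₁≈u₁ i = trans (proj-· ν₁ u₁ u₁ i) (trans (*-congˡ ν₁≈1) (*-identityʳ _))
        Q₁u₁≈0 : ∀ i → (Q₁ · u₁) i ≈ 0#
        Q₁u₁≈0 i = begin
          (Q₁ · u₁) i               ≈⟨ dot-cong {x = Q₁ i} (λ _ → refl) e₁u₁≈u₁ ⟨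
          (Q₁ · (e₁ · u₁)) i        ≈⟨ ·-· Q₁ e₁ u₁ i ⟨
          ((Q₁ *ᴹ e₁) · u₁) i       ≈⟨ dot-cong {y = u₁} (C₁.complement-e i) (λ _ → refl) ⟩
          dot (λ _ → 0#) u₁         ≈⟨ sum-zero _ (λ k → zeroˡ (u₁ k)) ⟩
          0#                        ∎

    -- Invertibility from the determinant, and the decomposition for matrices.

    row-* : (A : Matrix n) (j : Fin n) (y : Vector Carrier n) → ∀ k → (I [ j ≔ y ] *ᴹ A) j k ≈ dot y (λ i → A i k)
    row-* A j y k = dot-cong {y = λ i → A i k} (≔-updates I j y) (λ _ → refl)

    -- An obstruction `y` to the j-th column equation annihilates `A`. Putting `y` in row j of the
    -- identity and multiplying by `A` yields a zero row, while the determinant of this product is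
    -- `y j * det A`; so `y j` vanishes, against the choice of `y`.
    rightInverse : (A : Matrix n) → ¬ det A ≈ 0# → Σ[ C ∈ Matrix n ] A *ᴹ C ≈ᴹ I
    rightInverse A det≉0 = (λ i j → proj₁ (column j) i) , (λ i j → proj₂ (column j) i)
      where
      column : ∀ j → Σ[ x ∈ Vector Carrier n ] (∀ i → (A · x) i ≈ I i j)
      column j with fredholm A (λ i → I i j)
      ... | inj₁ solution = solution
      ... | inj₂ (y , yA≈0 , yⱼ≉0) = contradiction (trans (sum-*-I y j) (*-cancel-≉0 det≉0 (begin
        det A * y j                                  ≈⟨ *-comm _ _ ⟩
        y j * det A                                  ≈⟨ *-congʳ (det-I≔ j y) ⟨
        det (I [ j ≔ y ]) * det A                    ≈⟨ det-* (I [ j ≔ y ]) A ⟨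
        det (I [ j ≔ y ] *ᴹ A)                       ≈⟨ det-cong (≔-self (I [ j ≔ y ] *ᴹ A) j (λ k → sym (trans (row-* A j y k) (yA≈0 k)))) ⟨
        det ((I [ j ≔ y ] *ᴹ A) [ j ≔ (λ _ → 0#) ])  ≈⟨ Multilinear.zero-row det-multilinear (I [ j ≔ y ] *ᴹ A) j ⟩
        0#                                           ∎))) yⱼ≉0

    orthogonal-decomposition : (h : Matrix n) → ε̃ h *ᴹ h ≈ᴹ I → det h ≈ 1# →
      (∀ A → (h +ᴹ I) *ᴹ ((h +ᴹ I) *ᴹ A) ≈ᴹ M.0# → (h +ᴹ I) *ᴹ A ≈ᴹ M.0#) →
      Σ[ Y ∈ Matrix n ] Σ[ Y⁻¹ ∈ Matrix n ] (Y⁻¹ *ᴹ Y ≈ᴹ I × Y *ᴹ Y⁻¹ ≈ᴹ I) ×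
      Σ[ X ∈ Matrix n ] (Y +ᴹ ε̃ Y ≈ᴹ X *ᴹ X ′) × (h ≈ᴹ -ᴹ (I -ᴹ X ′ *ᴹ Y⁻¹ *ᴹ X))
    orthogonal-decomposition h h⋆h≈I det-h≈1 reduced = G.decomposition skewUnit
      where
      hh⋆≈I : h *ᴹ ε̃ h ≈ᴹ I
      hh⋆≈I with rightInverse h (λ det≈0 → 1≉0 (trans (sym det-h≈1) det≈0))
      -- A left inverse and a right inverse of the same element agree.
      ... | C , hC≈I = M.trans (M.*-congˡ {h} (MR.begin
        ε̃ h                    MR.≈⟨ M.*-identityʳ (ε̃ h) ⟨
        ε̃ h *ᴹ I               MR.≈⟨ M.*-congˡ {ε̃ h} hC≈I ⟨
        ε̃ h *ᴹ (h *ᴹ C)        MR.≈⟨ M.*-assoc (ε̃ h) h C ⟨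
        ε̃ h *ᴹ h *ᴹ C          MR.≈⟨ M.*-congʳ {C} h⋆h≈I ⟩
        I *ᴹ C                 MR.≈⟨ M.*-identityˡ C ⟩
        C                      MR.∎)) hC≈I

      module O = OrthogonalElement h h⋆h≈I hh⋆≈I reduced
      open O using (g)

      groupInverse : ∀ j → Σ[ x ∈ Vector Carrier n ] (∀ i → ((g *ᴹ g) · x) i ≈ g i j)
      groupInverse j with fredholm (g *ᴹ g) (λ i → g i j)
      ... | inj₁ solution = solution
      -- The ring statement is applied to the square matrix all of whose rows are `y`.
      ... | inj₂ (y , ygg≈0 , yg≉0) = contradiction (O.reducedˡ (λ _ → y) (λ _ → ygg≈0) j j) yg≉0

      X₀ : Matrix n
      X₀ i j = proj₁ (groupInverse j) i

      module G = O.GroupInverse X₀ (M.trans (M.sym (M.*-assoc g g X₀)) (λ i j → proj₂ (groupInverse j) i))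
      open G using (q)

      det-reflection-q : det (reflection q) ≈ 1#
      det-reflection-q = begin
        det (reflection q)                                              ≈⟨ *-identityʳ _ ⟨
        det (reflection q) * 1#                                         ≈⟨ *-congˡ det-G ⟨
        det (reflection q) * (det (g +ᴹ q) * det (G.n +ᴹ q))            ≈⟨ *-assoc _ _ _ ⟨
        det (reflection q) * det (g +ᴹ q) * det (G.n +ᴹ q)              ≈⟨ *-congʳ factor ⟩
        det (g +ᴹ q) * det (G.n +ᴹ q)                                   ≈⟨ det-G ⟩
        1#                                                              ∎
        where
        det-G : det (g +ᴹ q) * det (G.n +ᴹ q) ≈ 1#
        det-G = trans (sym (det-* (g +ᴹ q) (G.n +ᴹ q))) (trans (det-cong G.[g+q][n+q]≈1) (det-I n))
        factor : det (reflection q) * det (g +ᴹ q) ≈ det (g +ᴹ q)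
        factor = sym (begin
          det (g +ᴹ q)                                            ≈⟨ det-cong G.g+q≈h[g+q]⋆[1-2q] ⟩
          det (h *ᴹ (ε̃ (g +ᴹ q) *ᴹ reflection q))                 ≈⟨ det-* h (ε̃ (g +ᴹ q) *ᴹ reflection q) ⟩
          det h * det (ε̃ (g +ᴹ q) *ᴹ reflection q)                ≈⟨ *-cong det-h≈1 (det-* (ε̃ (g +ᴹ q)) (reflection q)) ⟩
          1# * (det (ε̃ (g +ᴹ q)) * det (reflection q))            ≈⟨ *-identityˡ _ ⟩
          det (ε̃ (g +ᴹ q)) * det (reflection q)                   ≈⟨ *-congʳ (det-ε̃ (g +ᴹ q)) ⟩
          det (g +ᴹ q) * det (reflection q)                       ≈⟨ *-comm _ _ ⟩
          det (reflection q) * det (g +ᴹ q)                       ∎)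

      skewUnit : SkewUnit q
      skewUnit with skewUnit-or-improper (splits (allFin n) q G.q⋆≈q G.qq≈q (λ j → inj₁ (∈-allFin j))) G.q⋆≈q G.qq≈q
      ... | inj₁ U = U
      -- The determinant of the reflection would be both 1 and -1.
      ... | inj₂ improper = contradiction
        (trans (+-congˡ (trans (sym det-reflection-q) improper)) (-‿inverseʳ 1#)) 2≉0

-- Apartness, the zero test from the valuation, and descent from the algebraic closure.

module HeytingFieldLemmas (F : HeytingField c ℓ₁ ℓ₂) where
  open HeytingField F hiding (zero)
  open RingProperties (CommutativeRing.ring (fieldRing F))
  private module L = RingLemmas (CommutativeRing.ring (fieldRing F))
  open SetoidReasoning (CommutativeRing.setoid (fieldRing F))

  #0-inverse : ∀ {x} → x # 0# → Σ[ y ∈ Carrier ] y * x ≈ 1#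
  #0-inverse {x} x#0 with #⇒invertible x#0
  ... | y , y[x-0]≈1 , _ = y , trans (*-congˡ (sym (L.+-dropʳ -0#≈0#))) y[x-0]≈1

  1#0 : 1# # 0#
  1#0 = invertible⇒# (1# , trans (*-identityˡ _) 1-0≈1 , trans (*-identityʳ _) 1-0≈1)
    where
    1-0≈1 : 1# - 0# ≈ 1#
    1-0≈1 = L.+-dropʳ -0#≈0#

  -- The lemma is used in the algebraic closure, where no zero test is at hand, so there is no case
  -- split on z. Tightness allows assuming that `z * y` is apart from zero; with its inverse u, z y
  -- = (z y)(z y) u = y (z (z y)) u, which vanishes.
  z*zy≈0⇒zy≈0 : ∀ z y → z * (z * y) ≈ 0# → z * y ≈ 0#
  z*zy≈0⇒zy≈0 z y zzy≈0 = proj₁ (tight (z * y) 0#) λ zy#0 → #-irrefl (zy≈0 zy#0) zy#0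
    where
    zy≈0 : z * y # 0# → z * y ≈ 0#
    zy≈0 zy#0 with #0-inverse zy#0
    ... | u , uzy≈1 = begin
      z * y                    ≈⟨ *-identityʳ _ ⟨
      z * y * 1#               ≈⟨ *-congˡ uzy≈1 ⟨
      z * y * (u * (z * y))    ≈⟨ *-congˡ (*-comm u _) ⟩
      z * y * (z * y * u)      ≈⟨ *-assoc _ _ _ ⟨
      z * y * (z * y) * u      ≈⟨ *-congʳ (*-congʳ (*-comm z y)) ⟩
      y * z * (z * y) * u      ≈⟨ *-congʳ (*-assoc y z _) ⟩
      y * (z * (z * y)) * u    ≈⟨ *-congʳ (trans (*-congˡ zzy≈0) (zeroʳ y)) ⟩
      0# * u                   ≈⟨ zeroˡ u ⟩
      0#                       ∎

module _ (K : NonarchimedeanLocalField c ℓ₁ ℓ₂) where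
  open NonarchimedeanLocalField K using (heytingField; v; v-finite)
  open HeytingField heytingField
  open HeytingFieldLemmas heytingField

  valuation-dichotomy : ∀ x → x ≈ 0# ⊎ x # 0#
  valuation-dichotomy x with v x in vx
  ... | just _  = inj₂ (Equivalence.to (v-finite x) λ vx≡⊤ → contradiction (≡.trans (≡.sym vx) vx≡⊤) λ ())
  ... | nothing = inj₁ (proj₁ (tight x 0#) λ x#0 → Equivalence.from (v-finite x) x#0 vx)

  isDiscreteField : CharacteristicZero heytingField → IsDiscreteField (fieldRing heytingField)
  isDiscreteField char0 = record
    { zero? = zero? ; inverse = inverse
    -- `CharacteristicZero` speaks of `suc n`, so 2 is its instance at 1, and the multiple unfolds
    -- to 1 + (1 + 0).
    ; 2≉0 = λ 2≈0 → char0 1 (trans (+-congˡ (+-identityʳ 1#)) 2≈0) }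
    where
    zero? : ∀ x → Dec (x ≈ 0#)
    zero? x with valuation-dichotomy x
    ... | inj₁ x≈0 = yes x≈0
    ... | inj₂ x#0 = no λ x≈0 → #-irrefl x≈0 x#0
    inverse : ∀ {x} → ¬ x ≈ 0# → Σ[ y ∈ Carrier ] y * x ≈ 1#
    inverse {x} x≉0 with valuation-dichotomy x
    ... | inj₁ x≈0 = contradiction x≈0 x≉0
    ... | inj₂ x#0 = #0-inverse x#0

module _ {K : HeytingField c ℓ₁ ℓ₂} (isDiscreteField : IsDiscreteField (fieldRing K))
         (K̄ : AlgebraicClosure K c′ ℓ₁′ ℓ₂′) {n : ℕ} where
  open AlgebraicClosure K̄
  open IsRingHomomorphism ι-homomorphism
  open Matrices (fieldRing K) using (Matrix; _≈ᴹ_; _+ᴹ_; _*ᴹ_; I)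
  private
    module F = CommutativeRing (fieldRing K)
    module E = CommutativeRing (fieldRing closure)
    module Ē where
      open Matrices (fieldRing closure) public
      open MatrixRing (fieldRing closure) public
      open HeytingFieldLemmas closure public
    module N = Ring (Ē.matrixRing n)
    module NL = RingLemmas (Ē.matrixRing n)
    module NR = SetoidReasoning N.setoid
    module ∑F = SemiringSum F.semiring
    module ∑E = SemiringSum E.semiring

  -- A nonzero element is a unit and its image would be a unit equal to zero. The zero test in the
  -- base field turns this refutation into an equation, and so brings identities back from the
  -- closure.
  ι-injective₀ : ∀ x → ι x E.≈ E.0# → x F.≈ F.0#
  ι-injective₀ x ιx≈0 with IsDiscreteField.zero? isDiscreteField x
  ... | yes x≈0 = x≈0
  ... | no x≉0 with IsDiscreteField.inverse isDiscreteField x≉0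
  ...   | y , yx≈1 = contradiction Ē.1#0 (HeytingField.#-irrefl closure (begin
    E.1#             ≈⟨ 1#-homo ⟨
    ι F.1#           ≈⟨ ⟦⟧-cong yx≈1 ⟨
    ι (y F.* x)      ≈⟨ *-homo y x ⟩
    ι y E.* ι x      ≈⟨ E.*-congˡ ιx≈0 ⟩
    ι y E.* E.0#     ≈⟨ E.zeroʳ (ι y) ⟩
    E.0#             ∎))
    where open SetoidReasoning E.setoid

  ι-sum : ∀ {m} (f : Vector F.Carrier m) → ι (∑F.sum f) E.≈ ∑E.sum (ι ∘ f)
  ι-sum {ℕ.zero}  f = 0#-homo
  ι-sum {ℕ.suc m} f = E.trans (+-homo _ _) (E.+-congˡ (ι-sum (f ∘ suc)))

  ιᴹ : Matrix n → Ē.Matrix n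
  ιᴹ = map (map ι)

  ιᴹ-* : ∀ A B → ιᴹ (A *ᴹ B) Ē.≈ᴹ ιᴹ A Ē.*ᴹ ιᴹ B
  ιᴹ-* A B i j = E.trans (ι-sum (λ k → A i k F.* B k j)) (Ē.∑-cong n (λ k → *-homo (A i k) (B k j)))

  ιᴹ-+I : ∀ A → ιᴹ (A +ᴹ I) Ē.≈ᴹ ιᴹ A Ē.+ᴹ Ē.I
  ιᴹ-+I A i j = E.trans (+-homo _ _) (E.+-congˡ (ι-I i j))
    where
    ι-I : ∀ i j → ι (I i j) E.≈ Ē.I i j
    ι-I i j with i ≟ j
    ... | yes _ = 1#-homo
    ... | no _  = 0#-homo

  -- Zero is a semisimple eigenvalue of a diagonalizable matrix: after a change
  -- of basis g acts on each row by a scalar z, and z² y = 0 implies z y = 0.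
  semisimple⇒reduced : ∀ h → Semisimple K̄ h → ∀ A →
    (h +ᴹ I) *ᴹ ((h +ᴹ I) *ᴹ A) ≈ᴹ (λ _ _ → F.0#) → (h +ᴹ I) *ᴹ A ≈ᴹ (λ _ _ → F.0#)
  semisimple⇒reduced h (P , (P⁻¹ , P⁻¹P≈I , PP⁻¹≈I) , d , P⁻¹hP≈D) A ggA≈0 i j = ι-injective₀ _ (ιgA≈0 i j)
    where
    g : Matrix n
    g = h +ᴹ I
    ḡ D+I C : Ē.Matrix n
    ḡ = ιᴹ g
    D+I = Ē.diagonal d Ē.+ᴹ Ē.I
    C = P⁻¹ Ē.*ᴹ ιᴹ A
    P⁻¹ḡ : P⁻¹ Ē.*ᴹ ḡ Ē.≈ᴹ D+I Ē.*ᴹ P⁻¹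
    P⁻¹ḡ = NR.begin
      P⁻¹ N.* ḡ                                      NR.≈⟨ N.*-congˡ {P⁻¹} (ιᴹ-+I h) ⟩
      P⁻¹ N.* (ιᴹ h N.+ N.1#)                        NR.≈⟨ N.distribˡ P⁻¹ (ιᴹ h) N.1# ⟩
      P⁻¹ N.* ιᴹ h N.+ P⁻¹ N.* N.1#                  NR.≈⟨ N.+-cong (NR.begin
        P⁻¹ N.* ιᴹ h                                   NR.≈⟨ N.*-identityʳ _ ⟨
        P⁻¹ N.* ιᴹ h N.* N.1#                          NR.≈⟨ N.*-congˡ {P⁻¹ N.* ιᴹ h} PP⁻¹≈I ⟨
        P⁻¹ N.* ιᴹ h N.* (P N.* P⁻¹)                   NR.≈⟨ N.*-assoc (P⁻¹ N.* ιᴹ h) P P⁻¹ ⟨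
        P⁻¹ N.* ιᴹ h N.* P N.* P⁻¹                     NR.≈⟨ N.*-congʳ {P⁻¹} P⁻¹hP≈D ⟩
        Ē.diagonal d N.* P⁻¹                           NR.∎)
          (N.trans (N.*-identityʳ P⁻¹) (N.sym (N.*-identityˡ P⁻¹))) ⟩
      Ē.diagonal d N.* P⁻¹ N.+ N.1# N.* P⁻¹          NR.≈⟨ N.distribʳ P⁻¹ (Ē.diagonal d) N.1# ⟨
      D+I N.* P⁻¹                                    NR.∎
    P⁻¹ḡ-* : ∀ B → P⁻¹ N.* (ḡ N.* B) N.≈ D+I N.* (P⁻¹ N.* B)
    P⁻¹ḡ-* B = N.trans (NL.pullˡ B P⁻¹ḡ) (N.*-assoc D+I P⁻¹ B)
    scale : ∀ B i j → (D+I N.* B) i j E.≈ (d i E.+ E.1#) E.* B i j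
    scale B i j = E.trans (N.distribʳ B (Ē.diagonal d) Ē.I i j)
      (E.trans (E.+-cong (Ē.sum-diagonal-* d (λ k → B k j) i) (E.trans (Ē.sum-I-* (λ k → B k j) i) (E.sym (E.*-identityˡ _))))
        (E.sym (E.distribʳ _ _ _)))
    ggC≈0 : D+I N.* (D+I N.* C) N.≈ N.0#
    ggC≈0 = NR.begin
      D+I N.* (D+I N.* C)                  NR.≈⟨ N.*-congˡ {D+I} (P⁻¹ḡ-* (ιᴹ A)) ⟨
      D+I N.* (P⁻¹ N.* (ḡ N.* ιᴹ A))       NR.≈⟨ P⁻¹ḡ-* (ḡ N.* ιᴹ A) ⟨
      P⁻¹ N.* (ḡ N.* (ḡ N.* ιᴹ A))         NR.≈⟨ N.*-congˡ {P⁻¹} (N.trans (ιᴹ-* g (g *ᴹ A)) (N.*-congˡ {ḡ} (ιᴹ-* g A))) ⟨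
      P⁻¹ N.* ιᴹ (g *ᴹ (g *ᴹ A))           NR.≈⟨ N.*-congˡ {P⁻¹} (λ i j → E.trans (⟦⟧-cong (ggA≈0 i j)) 0#-homo) ⟩
      P⁻¹ N.* N.0#                         NR.≈⟨ N.zeroʳ P⁻¹ ⟩
      N.0#                                 NR.∎
    gC≈0 : D+I N.* C N.≈ N.0#
    gC≈0 i j = E.trans (scale C i j) (Ē.z*zy≈0⇒zy≈0 _ _
      (E.trans (E.*-congˡ (E.sym (scale C i j))) (E.trans (E.sym (scale (D+I N.* C) i j)) (ggC≈0 i j))))
    ιgA≈0 : ιᴹ (g *ᴹ A) N.≈ N.0#
    ιgA≈0 = NR.begin
      ιᴹ (g *ᴹ A)                          NR.≈⟨ ιᴹ-* g A ⟩
      ḡ N.* ιᴹ A                           NR.≈⟨ N.*-identityˡ _ ⟨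
      N.1# N.* (ḡ N.* ιᴹ A)                NR.≈⟨ N.*-congʳ {ḡ N.* ιᴹ A} PP⁻¹≈I ⟨
      P N.* P⁻¹ N.* (ḡ N.* ιᴹ A)           NR.≈⟨ N.*-assoc P P⁻¹ _ ⟩
      P N.* (P⁻¹ N.* (ḡ N.* ιᴹ A))         NR.≈⟨ N.*-congˡ {P} (N.trans (P⁻¹ḡ-* (ιᴹ A)) gC≈0) ⟩
      P N.* N.0#                           NR.≈⟨ N.zeroʳ P ⟩
      N.0#                                 NR.∎

open import Data.Nat.Base using (_*_)

proposition2p7 : ∀ {c ℓ₁ ℓ₂ c′ ℓ₁′ ℓ₂′} (K : NonarchimedeanLocalField c ℓ₁ ℓ₂) →
    let F = NonarchimedeanLocalField.heytingField K
        open Matrices (fieldRing F)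
    in
    CharacteristicZero F →
    (F̄ : AlgebraicClosure F c′ ℓ₁′ ℓ₂′) →
    (m : ℕ) (h : Matrix (suc (2 * m))) →
    SpecialOrthogonal h →
    Semisimple F̄ h →
    Σ[ Y ∈ Matrix (suc (2 * m)) ] Σ[ (Y⁻¹ , _) ∈ Invertible Y ]
    Σ[ X ∈ Matrix (suc (2 * m)) ]
      (Y +ᴹ ε̃ Y ≈ᴹ X *ᴹ X ′) ×
      (h ≈ᴹ -ᴹ (I -ᴹ X ′ *ᴹ Y⁻¹ *ᴹ X))
proposition2p7 K char0 F̄ m h h∈SO semisimple =
  let Y , Y⁻¹ , inverse , X , Y+ε̃Y , h≈ =
        orthogonal-decomposition h ε̃h*h≈I det≈1 (semisimple⇒reduced discrete F̄ h semisimple)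
  in Y , (Y⁻¹ , inverse) , X , Y+ε̃Y , h≈
  where
  F = NonarchimedeanLocalField.heytingField K
  discrete : IsDiscreteField (fieldRing F)
  discrete = isDiscreteField K char0
  open Matrices (fieldRing F)
  open SpecialOrthogonal h∈SO
  open MatrixRing (fieldRing F)
  open DiscreteField (fieldRing F) discrete
  module M = Ring (matrixRing (suc (2 * m)))
  ε̃h*h≈I : ε̃ h *ᴹ h ≈ᴹ I
  ε̃h*h≈I = M.trans (M.*-congʳ {h} (M.*-assoc w (transpose h) w))
    (M.trans (M.*-assoc w (transpose h *ᴹ w) h) (M.trans (M.*-congˡ {w} preserves-w) w*w≈I))
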